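{- Let $\theta$ be a large enough regular cardinal, $(X,\tau)\in H(\theta)$ a Lindelöf topological space, and $\mathbb{P}\in H(\theta)$ a poset. Suppose that the set of countable $M\prec H(\theta)$ such that $\mathbb{P}$ is strongly proper for $M$ is stationary in $[H(\theta)]^{\aleph_0}$. Then $\mathbb{P}$ forces that $(X,\tau)$ is Lindelöf.
   Context: $H(\theta)$ is the collection of sets hereditarily of cardinality $<\theta$; "large enough" has its usual meaning ($\theta\ge\omega_2$ and $H(\theta)$ contains all relevant objects, such as power sets, topologies, and names built from $\mathbb{P}$ and $X$). Strong properness. Let $M\prec H(\theta)$ be countable with $\mathbb{P}\in M$. For $q\in\mathbb{P}$, a condition $\bar q\in M\cap\mathbb{P}$ is a residue of $q$ to $M$ if every $s\le\bar q$ with $s\in M$ is compatible with $q$. A condition $p\in\mathbb{P}$ is $(M,\mathbb{P})$-strongly generic if every $q\le p$ has a residue to $M$. $\mathbb{P}$ is strongly proper for $M$ if every $s\in M\cap\mathbb{P}$ can be extended to an $(M,\mathbb{P})$-strongly generic condition. Preservation. If $G$ is $V$-generic over $\mathbb{P}$, then $\tau^G$ denotes the topology on $X$ in $V[G]$ having $\tau$ as a basis. "$\mathbb{P}$ forces that $(X,\tau)$ has property $\Phi$" means that every condition forces that $(X,\tau^{\dot G})$ has property $\Phi$. A space is Lindelöf if every open cover has a countable subcover (no separation axioms are assumed). -}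

module Defs where

open import Axiom.ExcludedMiddle using (ExcludedMiddle)
open import Data.Bool using (Bool; true; false; T)
open import Data.Fin using (Fin)
open import Data.Nat using (ℕ; zero; suc)
open import Data.Product using (Σ; Σ-syntax; ∃-syntax; _×_; _,_; proj₁; proj₂)
open import Data.Sum using (_⊎_; inj₁; inj₂)
open import Data.Unit using (⊤; tt)
open import Data.Vec using (Vec; _∷_; lookup; map)
open import Function using (_∘_)
open import Function.Bundles using (Func; Injection; Bijection; _⇔_)
open import Level using (Lift; 0ℓ; Setω) renaming (suc to lsuc)
open import Relation.Binary.Bundles using (Setoid)
open import Relation.Binary.PropositionalEquality using (setoid)
open import Relation.Binary.Structures using (IsPartialOrder)
open import Relation.Nullary using (¬_)

-- The metatheory is made classical by assuming this.  Since Dec A is not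
-- truncated, it also yields choice; with it, the universe V below is a model
-- of ZFC.

Classical : Setω
Classical = ∀ {ℓ} → ExcludedMiddle ℓ

------------------------------------------------------------------------
-- The set-theoretic universe (Aczel's well-founded trees up to
-- bisimilarity).  A tree may list the same element several times, so every
-- notion below has to be read up to _≈_.

data V : Set₁ where
  sup : (A : Set) (f : A → V) → V

Ix : V → Set
Ix (sup A f) = A

el : (x : V) → Ix x → V
el (sup A f) = f

infix 4 _≈_ _∈_ _⊆_ _<ᶜ_

_≈_ : V → V → Set
sup A f ≈ sup B g =
  (∀ a → ∃[ b ] f a ≈ g b) × (∀ b → ∃[ a ] f a ≈ g b)

_∈_ : V → V → Set
x ∈ y = ∃[ i ] x ≈ el y i

_⊆_ : V → V → Set₁
x ⊆ y = ∀ z → z ∈ x → z ∈ y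

≈-refl : ∀ x → x ≈ x
≈-refl (sup A f) = (λ a → a , ≈-refl (f a)) , (λ a → a , ≈-refl (f a))

≈-sym : ∀ x y → x ≈ y → y ≈ x
≈-sym (sup A f) (sup B g) (p , q) =
  (λ b → proj₁ (q b) , ≈-sym (f (proj₁ (q b))) (g b) (proj₂ (q b))) ,
  (λ a → proj₁ (p a) , ≈-sym (f a) (g (proj₁ (p a))) (proj₂ (p a)))

≈-trans : ∀ x y z → x ≈ y → y ≈ z → x ≈ z
≈-trans (sup A f) (sup B g) (sup C h) (p , q) (r , s) =
  (λ a → let (b , ab) = p a ; (c , bc) = r b
         in c , ≈-trans (f a) (g b) (h c) ab bc) ,
  (λ c → let (b , bc) = s c ; (a , ab) = q b
         in a , ≈-trans (f a) (g b) (h c) ab bc)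

-- The elements of x, as a setoid.  Functions between sets are setoid
-- functions: each is given by a graph in V, and conversely.

⟦_⟧ : V → Setoid 0ℓ 0ℓ
⟦ x ⟧ = record
  { Carrier = Ix x
  ; _≈_ = λ i j → el x i ≈ el x j
  ; isEquivalence = record
    { refl  = λ {i} → ≈-refl (el x i)
    ; sym   = λ {i} {j} → ≈-sym (el x i) (el x j)
    ; trans = λ {i} {j} {k} → ≈-trans (el x i) (el x j) (el x k)
    }
  }

⁅_,_⁆ : V → V → V
⁅ x , y ⁆ = sup Bool λ { true → x ; false → y }

⟨_,_⟩ : V → V → V
⟨ x , y ⟩ = ⁅ ⁅ x , x ⁆ , ⁅ x , y ⁆ ⁆

_⊗_ : V → V → V
x ⊗ y = sup (Ix x × Ix y) λ (i , j) → ⟨ el x i , el y j ⟩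

-- The full power set, because the metatheory is classical: every predicate
-- on Ix x is then decidable, i.e. given by a Bool-valued function.

𝒫 : V → V
𝒫 x = sup (Ix x → Bool) λ χ → sup (Σ[ i ∈ Ix x ] T (χ i)) (el x ∘ proj₁)

successor : V → V
successor x = sup (Ix x ⊎ Fin 1) λ { (inj₁ i) → el x i ; (inj₂ _) → x }

numeral : ℕ → V
numeral zero    = sup (Fin 0) λ ()
numeral (suc n) = successor (numeral n)

ω : V
ω = sup ℕ numeral

⋃ₙ : (ℕ → V) → V
⋃ₙ s = sup (Σ[ n ∈ ℕ ] Ix (s n)) λ (n , i) → el (s n) i

------------------------------------------------------------------------

_<ᶜ_ : V → V → Set
x <ᶜ y = Injection ⟦ x ⟧ ⟦ y ⟧ × ¬ Injection ⟦ y ⟧ ⟦ x ⟧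

IsTransitive : V → Set₁
IsTransitive x = ∀ y → y ∈ x → y ⊆ x

IsOrdinal : V → Set₁
IsOrdinal α = IsTransitive α × (∀ β → β ∈ α → IsTransitive β)

IsCardinal : V → Set₁
IsCardinal κ = IsOrdinal κ × (∀ α → α ∈ κ → ¬ Injection ⟦ κ ⟧ ⟦ α ⟧)

IsRegular : V → Set₁
IsRegular θ =
  IsCardinal θ × ω ⊆ θ ×
  (∀ α → α ∈ θ → (f : Func ⟦ α ⟧ ⟦ θ ⟧) →
     ∃[ β ] β ∈ θ × (∀ i → el θ (Func.to f i) ∈ β))

IsSuccessorCardinal : V → V → Set₁
IsSuccessorCardinal κ μ =
  IsCardinal μ × κ ∈ μ ×
  (∀ ν → IsCardinal ν → κ ∈ ν → μ ⊆ ν)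

ω₂≤ : V → Set₁
ω₂≤ θ = ∃[ ω₁ ] ∃[ ω₂ ]
  IsSuccessorCardinal ω ω₁ × IsSuccessorCardinal ω₁ ω₂ × ω₂ ⊆ θ

-- x ∈ H(θ): x, its members, their members, … all have cardinality < θ.

H : V → V → Set
H θ (sup A f) = sup A f <ᶜ θ × (∀ a → H θ (f a))

-- "θ is large enough" for a topology τ on X and a set P of conditions.  Nice P-names for subsets of X, resp. of τ, are
-- subsets of X ⊗ P, resp. of τ ⊗ P.

record LargeEnough (θ X τ P : V) : Set₁ where
  field
    above-ω₂      : ω₂≤ θ
    subfamilies   : H θ (𝒫 (𝒫 X))
    conditions    : H θ (𝒫 P)
    point-names   : H θ (𝒫 (X ⊗ P))
    basis-names   : H θ (𝒫 (τ ⊗ P))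

------------------------------------------------------------------------
-- Stationarity in [K]^ℵ₀, where the class K is (for K = H θ) a set, so that
-- its subclasses are sets too.

infix 4 _∈[_]^ℵ₀

_∈[_]^ℵ₀ : V → (V → Set) → Set₁
x ∈[ K ]^ℵ₀ = (∀ z → z ∈ x → K z) × Bijection (setoid ℕ) ⟦ x ⟧

record IsClub (K : V → Set) (C : V → Set) : Set₁ where
  field
    respects  : ∀ x y → x ≈ y → C x → C y
    countable : ∀ x → C x → x ∈[ K ]^ℵ₀
    unbounded : ∀ x → x ∈[ K ]^ℵ₀ → ∃[ y ] C y × x ⊆ y
    closed    : (s : ℕ → V) → (∀ n → C (s n)) → (∀ n → s n ⊆ s (suc n)) →
                C (⋃ₙ s)

IsStationary : (K : V → Set) (S : V → Set₁) → Set₁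
IsStationary K S = ∀ C → IsClub K C → ∃[ M ] C M × S M

------------------------------------------------------------------------
-- Interpretations of the first-order language of set theory.  Ω is the type
-- of truth values: propositions for satisfaction in a structure, predicates
-- on conditions for forcing.  ∨, ⇒, ⇔ and ∃ are the usual classical
-- abbreviations.

record Interpretation : Set₃ where
  infix  8 _∈̇_ _≐_
  infix  7 ¬̇_
  infixr 6 _∧̇_
  infixr 5 _∨̇_
  infixr 4 _⇒̇_
  infix  3 _⇔̇_
  field
    Dom  : Set₁
    Ω    : Set₂
    _∈̇_  : Dom → Dom → Ω
    _≐_  : Dom → Dom → Ω
    ¬̇_   : Ω → Ω
    _∧̇_  : Ω → Ω → Ω
    ∀̇    : (Dom → Ω) → Ω

  _∨̇_ _⇒̇_ _⇔̇_ : Ω → Ω → Ω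
  φ ∨̇ ψ = ¬̇ (¬̇ φ ∧̇ ¬̇ ψ)
  φ ⇒̇ ψ = ¬̇ (φ ∧̇ ¬̇ ψ)
  φ ⇔̇ ψ = (φ ⇒̇ ψ) ∧̇ (ψ ⇒̇ φ)

  ∃̇ : (Dom → Ω) → Ω
  ∃̇ φ = ¬̇ ∀̇ λ x → ¬̇ φ x

  ∀∈ ∃∈ : Dom → (Dom → Ω) → Ω
  ∀∈ a φ = ∀̇ λ x → x ∈̇ a ⇒̇ φ x
  ∃∈ a φ = ∃̇ λ x → x ∈̇ a ∧̇ φ x

data Formula (n : ℕ) : Set where
  mem eq : Fin n → Fin n → Formula n
  neg    : Formula n → Formula n
  and    : Formula n → Formula n → Formula n
  all    : Formula (suc n) → Formula n

module _ (I : Interpretation) where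
  open Interpretation I

  eval : ∀ {n} → Formula n → Vec Dom n → Ω
  eval (mem i j) ρ = lookup ρ i ∈̇ lookup ρ j
  eval (eq i j)  ρ = lookup ρ i ≐ lookup ρ j
  eval (neg φ)   ρ = ¬̇ eval φ ρ
  eval (and φ ψ) ρ = eval φ ρ ∧̇ eval ψ ρ
  eval (all φ)   ρ = ∀̇ λ x → eval φ (x ∷ ρ)

structure : (V → Set) → Interpretation
structure K = record
  { Dom = Σ V K
  ; Ω   = Set₁
  ; _∈̇_ = λ x y → Lift (lsuc 0ℓ) (proj₁ x ∈ proj₁ y)
  ; _≐_ = λ x y → Lift (lsuc 0ℓ) (proj₁ x ≈ proj₁ y)
  ; ¬̇_  = ¬_
  ; _∧̇_ = _×_
  ; ∀̇   = λ φ → ∀ x → φ x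
  }

universe : Interpretation
universe = structure (λ _ → ⊤)

infix 4 _≺_

_≺_ : V → (V → Set) → Set₁
M ≺ K = Σ[ M⊆K ∈ (∀ x → x ∈ M → K x) ]
  (∀ n (φ : Formula n) (ρ : Vec (Σ V (_∈ M)) n) →
     eval (structure (_∈ M)) φ ρ ⇔
     eval (structure K) φ (map (λ (x , x∈M) → x , M⊆K x x∈M) ρ))

------------------------------------------------------------------------
-- The topological notions, as formulas, so that they can be both evaluated
-- in the universe and forced.

module Properties (I : Interpretation) where
  open Interpretation I

  infix 8 _⊆̇_

  _⊆̇_ : Dom → Dom → Ω
  a ⊆̇ b = ∀∈ a λ x → x ∈̇ b

  IsDoubleton : Dom → Dom → Dom → Ω
  IsDoubleton z a b = ∀̇ λ y → y ∈̇ z ⇔̇ y ≐ a ∨̇ y ≐ b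

  IsPair : Dom → Dom → Dom → Ω
  IsPair z a b = ∀̇ λ w → w ∈̇ z ⇔̇ IsDoubleton w a a ∨̇ IsDoubleton w a b

  Maps : Dom → Dom → Dom → Ω
  Maps f a b = ∃∈ f λ z → IsPair z a b

  IsFunctional : Dom → Ω
  IsFunctional f =
    ∀̇ λ a → ∀̇ λ b → ∀̇ λ c → Maps f a b ∧̇ Maps f a c ⇒̇ b ≐ c

  IsEmpty : Dom → Ω
  IsEmpty z = ∀̇ λ y → ¬̇ y ∈̇ z

  IsSuccessor : Dom → Dom → Ω
  IsSuccessor m n = ∀̇ λ y → y ∈̇ m ⇔̇ y ∈̇ n ∨̇ y ≐ n

  IsInductive : Dom → Ω
  IsInductive w = ∃∈ w IsEmpty ∧̇ ∀∈ w λ n → ∃∈ w λ m → IsSuccessor m n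

  Isω : Dom → Ω
  Isω w = IsInductive w ∧̇ ∀̇ λ v → IsInductive v ⇒̇ w ⊆̇ v

  -- d is contained in the image of a partial function on ω (partial, so as
  -- to cover empty and finite d).
  IsCountable : Dom → Ω
  IsCountable d = ∃̇ λ w → ∃̇ λ f →
    Isω w ∧̇ IsFunctional f ∧̇ ∀∈ d λ x → ∃∈ w λ n → Maps f n x

  IsIntersection : Dom → Dom → Dom → Ω
  IsIntersection z u v = ∀̇ λ x → x ∈̇ z ⇔̇ x ∈̇ u ∧̇ x ∈̇ v

  IsUnion : Dom → Dom → Ω
  IsUnion u s = ∀̇ λ x → x ∈̇ u ⇔̇ ∃∈ s λ v → x ∈̇ v

  -- The empty set is open, as the union of the empty family.
  IsTopology : Dom → Dom → Ω
  IsTopology X τ =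
      (∀∈ τ λ u → u ⊆̇ X)
    ∧̇ X ∈̇ τ
    ∧̇ (∀∈ τ λ u → ∀∈ τ λ v → ∀̇ λ z → IsIntersection z u v ⇒̇ z ∈̇ τ)
    ∧̇ (∀̇ λ s → s ⊆̇ τ ⇒̇ ∀̇ λ u → IsUnion u s ⇒̇ u ∈̇ τ)

  Covers : Dom → Dom → Ω
  Covers c X = ∀∈ X λ x → ∃∈ c λ u → x ∈̇ u

  IsLindelöf : Dom → Dom → Ω
  IsLindelöf X τ = ∀̇ λ c → c ⊆̇ τ ∧̇ Covers c X ⇒̇
    ∃̇ λ d → d ⊆̇ c ∧̇ IsCountable d ∧̇ Covers d X

  -- σ is the topology with basis β: its members are exactly the unions of
  -- members of β.
  HasBasis : Dom → Dom → Ω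
  HasBasis σ β = ∀̇ λ u →
    u ∈̇ σ ⇔̇ (∀∈ u λ x → ∃∈ β λ b → x ∈̇ b ∧̇ b ⊆̇ u)

  BasisGeneratesLindelöf : Dom → Dom → Ω
  BasisGeneratesLindelöf X β = ∃̇ λ σ → HasBasis σ β ∧̇ IsLindelöf X σ

IsTopologicalSpace : V → V → Set₁
IsTopologicalSpace X τ = Properties.IsTopology universe (X , tt) (τ , tt)

IsLindelöfSpace : V → V → Set₁
IsLindelöfSpace X τ = Properties.IsLindelöf universe (X , tt) (τ , tt)

------------------------------------------------------------------------
-- Forcing with the poset ⟨ P , L ⟩, where L is the set of pairs ⟨ p , q ⟩
-- with p ≤ q; stronger conditions are smaller.

module Forcing (P L : V) where

  Condition : Set
  Condition = Ix P

  infix 4 _≤_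

  _≤_ : Condition → Condition → Set
  p ≤ q = ⟨ el P p , el P q ⟩ ∈ L

  IsPoset : Set₁
  IsPoset =
    L ⊆ (P ⊗ P) × IsPartialOrder (λ p q → el P p ≈ el P q) _≤_

  _∈ᶜ_ : Condition → V → Set
  p ∈ᶜ M = el P p ∈ M

  Compatible : Condition → Condition → Set
  Compatible p q = ∃[ r ] r ≤ p × r ≤ q

  IsResidue : V → Condition → Condition → Set
  IsResidue M q q̄ = q̄ ∈ᶜ M × (∀ s → s ≤ q̄ → s ∈ᶜ M → Compatible s q)

  IsStronglyGeneric : V → Condition → Set
  IsStronglyGeneric M p = ∀ q → q ≤ p → ∃[ q̄ ] IsResidue M q q̄

  IsStronglyProperFor : V → Set
  IsStronglyProperFor M =
    ∀ s → s ∈ᶜ M → ∃[ p ] p ≤ s × IsStronglyGeneric M p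

  -- The name {(σ a , c a) : a ∈ A}.
  data Name : Set₁ where
    sup : (A : Set) (σ : A → Name) (c : A → Condition) → Name

  -- P need not have a largest element, so x̌ = {(y̌ , p) : y ∈ x, p ∈ P}.
  check : V → Name
  check (sup A f) =
    sup (A × Condition) (λ (a , _) → check (f a)) (λ (_ , p) → p)

  DenseBelow : Condition → (Condition → Set) → Set
  DenseBelow p D = ∀ q → q ≤ p → ∃[ r ] r ≤ q × D r

  infix 4 _⊩_≐_ _⊩_∈̇_

  -- p forces two names equal if below p each of them is forced to contain the
  -- members of the other; membership, as in _⊩_∈̇_, is unfolded here.
  _⊩_≐_ : Condition → Name → Name → Set
  p ⊩ sup A σ c ≐ sup B τ d =
    (∀ a q → q ≤ p → q ≤ c a →
       DenseBelow q λ r → ∃[ b ] r ≤ d b × r ⊩ σ a ≐ τ b) ×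
    (∀ b q → q ≤ p → q ≤ d b →
       DenseBelow q λ r → ∃[ a ] r ≤ c a × r ⊩ σ a ≐ τ b)

  _⊩_∈̇_ : Condition → Name → Name → Set
  p ⊩ ν ∈̇ sup B τ d = DenseBelow p λ r → ∃[ b ] r ≤ d b × r ⊩ ν ≐ τ b

  -- A truth value is identified with the predicate "p forces it".
  forcing : Interpretation
  forcing = record
    { Dom = Name
    ; Ω   = Condition → Set₁
    ; _∈̇_ = λ x y p → Lift (lsuc 0ℓ) (p ⊩ x ∈̇ y)
    ; _≐_ = λ x y p → Lift (lsuc 0ℓ) (p ⊩ x ≐ y)
    ; ¬̇_  = λ φ p → ∀ q → q ≤ p → ¬ φ q
    ; _∧̇_ = λ φ ψ p → φ p × ψ p
    ; ∀̇   = λ φ p → ∀ x → φ x p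
    }

  ForcesLindelöf : V → V → Set₁
  ForcesLindelöf X τ = ∀ p →
    Properties.BasisGeneratesLindelöf forcing (check X) (check τ) p

{-# OPTIONS --safe #-}

-- Let p force that c is a cover of X by open sets.  For s ≤ p, the basic open
-- sets U such that some t ≤ s forces U to be contained in some member of c
-- cover X in the ground model, so countably many of them do, with witnesses
-- t(s,n) and members a(s,n) of c.  Let M contain p, be closed under the
-- functions t(·,n) and under the choice of common extensions with p, and be
-- such that P is strongly proper for M.  Such an M exists by stationarity,
-- because the sets closed in this sense form a club.  Let r ≤ p be strongly
-- generic for M.  Then r forces the countable set of those a(s,n) with s in M
-- and t(s,n) in the generic filter to cover X: given x and q ≤ r, a residue of
-- q can be shrunk to an s ≤ p in M, some t(s,n) in M forces x into a(s,n), and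
-- t(s,n) is compatible with q.

module Submission where

open import Defs
open import Axiom.ExcludedMiddle using (ExcludedMiddle)
open import Data.Bool using (Bool; true; false; T; if_then_else_)
open import Data.Empty using (⊥-elim)
open import Data.Fin using (Fin; zero; toℕ; fromℕ<)
open import Data.Fin.Properties using (injective⇒≤; toℕ-injective; fromℕ<-injective)
open import Data.Maybe using (Maybe; just; nothing; maybe′)
open import Data.Nat using (ℕ; zero; suc; _+_; z≤n; s≤s)
import Data.Nat as ℕ
import Data.Nat.Properties as ℕ
open import Data.Product using (Σ; Σ-syntax; ∃; ∃-syntax; _×_; _,_; proj₁; proj₂; uncurry)
open import Data.Sum using (inj₁; inj₂)
open import Data.Unit using (tt)
open import Function using (_∘_; id)
open import Function.Bundles using (Injection; Bijection)
import Function.Construct.Composition as Compose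
open import Level using (lift; lower; 0ℓ) renaming (suc to lsuc)
open import Relation.Binary.Bundles using (Setoid)
open import Relation.Binary.Definitions using (tri<; tri≈; tri>)
open import Relation.Binary.PropositionalEquality using (_≡_; refl; sym; trans; cong; subst; setoid)
open import Relation.Binary.Structures using (IsPartialOrder)
open import Relation.Nullary using (¬_; Dec; yes; no; contradiction)
open import Relation.Nullary.Decidable using (True; isYes; toWitness; fromWitness; decidable-stable)

-- Countable sets

-- One step of Cantor's walk: along the current antidiagonal and, from its end, on to the start of
-- the next one.
next : ℕ × ℕ → ℕ × ℕ
next (a , zero)  = 0 , suc a
next (a , suc b) = suc a , b

unpair : ℕ → ℕ × ℕ
unpair zero    = 0 , 0
unpair (suc n) = next (unpair n)

-- Induction on `a`: the walk visits `(a , suc b)` immediately before `(suc a , b)`.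
unpair-along : ∀ a b → ∃[ n ] unpair n ≡ (0 , a + b) → ∃[ n ] unpair n ≡ (a , b)
unpair-along zero    b h = h
unpair-along (suc a) b h
  with n , e ← unpair-along a (suc b)
                 (subst (λ s → ∃[ n ] unpair n ≡ (0 , s)) (sym (ℕ.+-suc a b)) h)
  = suc n , cong next e

unpair-start : ∀ s → ∃[ n ] unpair n ≡ (0 , s)
unpair-start zero = 0 , refl
unpair-start (suc s)
  with n , e ← unpair-along s 0
                 (subst (λ s → ∃[ n ] unpair n ≡ (0 , s)) (sym (ℕ.+-identityʳ s)) (unpair-start s))
  = suc n , cong next e

unpair-surjective : ∀ a b → ∃[ n ] unpair n ≡ (a , b)
unpair-surjective a b = unpair-along a b (unpair-start (a + b))

least : Classical → {Q : ℕ → Set} → ∀ n → Q n → ∃[ m ] Q m × (∀ k → Q k → m ℕ.≤ k)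
least em zero q = 0 , q , λ _ _ → z≤n
least em {Q} (suc n) q with em {P = Q 0}
... | yes q₀ = 0 , q₀ , λ _ _ → z≤n
... | no ¬q₀ with m , r , min ← least em {Q ∘ suc} n q =
  suc m , r , λ { zero q₀ → contradiction q₀ ¬q₀ ; (suc k) qk → s≤s (min k qk) }

-- `_∈[_]^ℵ₀` asks for a bijection with ℕ, while the sets built below come with enumerations that
-- may repeat elements. Keeping only the indices at which a new element appears removes the
-- repetitions, and the injection `h` ensures that infinitely many indices remain.
module Enumeration (em : Classical) (S : Setoid 0ℓ 0ℓ) where
  open Setoid S using (Carrier)
    renaming (_≈_ to _~_; refl to ~-refl; sym to ~-sym; trans to ~-trans)

  module _ (f : ℕ → Carrier) (f-onto : ∀ s → ∃[ n ] f n ~ s)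
           (h : Injection (setoid ℕ) S) where

    New : ℕ → Set
    New k = ∀ j → j ℕ.< k → ¬ f j ~ f k

    new-index : ∀ s → ∃[ k ] f k ~ s × New k
    new-index s with k , fk~s , min ← uncurry (least em) (f-onto s) =
      k , fk~s , λ j j<k fj~fk → ℕ.<⇒≱ j<k (min j (~-trans fj~fk fk~s))

    -- If all new indices were below `N`, sending `n` to the new index of `h n` would inject `suc N`
    -- numbers into `N`.
    unbounded : ∀ N → ∃[ k ] N ℕ.≤ k × New k
    unbounded N with em {P = ∃[ k ] N ℕ.≤ k × New k}
    ... | yes found = found
    ... | no ¬found = contradiction (injective⇒≤ {suc N} {N} {code} code-injective) ℕ.1+n≰n
      where
      index : ℕ → ℕ
      index n = proj₁ (new-index (Injection.to h n))
      index< : ∀ n → index n ℕ.< N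
      index< n = ℕ.≰⇒> λ N≤ → ¬found (index n , N≤ , proj₂ (proj₂ (new-index (Injection.to h n))))
      code : Fin (suc N) → Fin N
      code i = fromℕ< (index< (toℕ i))
      code-injective : ∀ {i j} → code i ≡ code j → i ≡ j
      code-injective {i} {j} e = toℕ-injective (Injection.injective h
        (~-trans (~-sym (proj₁ (proj₂ (new-index _))))
          (subst (λ k → f k ~ Injection.to h (toℕ j))
            (sym (fromℕ<-injective _ _ (index< _) (index< _) e))
            (proj₁ (proj₂ (new-index _))))))

    first : ∀ N → ∃[ k ] (N ℕ.≤ k × New k) × (∀ m → N ℕ.≤ m × New m → k ℕ.≤ m)
    first N = uncurry (least em) (unbounded N)

    nth : ℕ → ℕ
    nth zero    = proj₁ (first 0)
    nth (suc n) = proj₁ (first (suc (nth n)))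

    nth-new : ∀ n → New (nth n)
    nth-new zero    = proj₂ (proj₁ (proj₂ (first 0)))
    nth-new (suc n) = proj₂ (proj₁ (proj₂ (first (suc (nth n)))))

    nth-suc : ∀ n → nth n ℕ.< nth (suc n)
    nth-suc n = proj₁ (proj₁ (proj₂ (first (suc (nth n)))))

    nth-mono : ∀ {m n} → m ℕ.< n → nth m ℕ.< nth n
    nth-mono {m} {suc n} (s≤s m≤n) with ℕ.m≤n⇒m<n∨m≡n m≤n
    ... | inj₁ m<n  = ℕ.<-trans (nth-mono m<n) (nth-suc n)
    ... | inj₂ refl = nth-suc n

    n≤nth : ∀ n → n ℕ.≤ nth n
    n≤nth zero    = z≤n
    n≤nth (suc n) = ℕ.≤-trans (s≤s (n≤nth n)) (nth-suc n)

    -- Let `n` be the least number with `k ≤ nth n`. The previous new index, if any, lies below `k`,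
    -- so `k` is a candidate in the minimum that defines `nth n`, whence `nth n ≤ k`.
    nth-onto : ∀ k → New k → ∃[ n ] nth n ≡ k
    nth-onto k new with least em {λ n → k ℕ.≤ nth n} k (n≤nth k)
    ... | zero , k≤ , _ = 0 , ℕ.≤-antisym (proj₂ (proj₂ (first 0)) k (z≤n , new)) k≤
    ... | suc n , k≤ , min = suc n , ℕ.≤-antisym
      (proj₂ (proj₂ (first (suc (nth n)))) k
        (ℕ.≰⇒> (λ k≤nth → ℕ.1+n≰n (min n k≤nth)) , new)) k≤

    nth-injective : ∀ {m n} → f (nth m) ~ f (nth n) → m ≡ n
    nth-injective {m} {n} e with ℕ.<-cmp m n
    ... | tri< m<n _ _ = contradiction e (nth-new n _ (nth-mono m<n))
    ... | tri≈ _ m≡n _ = m≡n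
    ... | tri> _ _ n<m = contradiction (~-sym e) (nth-new m _ (nth-mono n<m))

    bijection : Bijection (setoid ℕ) S
    bijection = record
      { to        = f ∘ nth
      ; cong      = λ { refl → ~-refl }
      ; bijective = nth-injective , onto
      }
      where
      onto : ∀ s → ∃[ n ] (∀ {m} → m ≡ n → f (nth m) ~ s)
      onto s with k , fk~s , new ← new-index s
             with n , refl ← nth-onto k new = n , λ { refl → fk~s }

-- Sets up to _≈_

∈-respˡ : ∀ {x y} z → x ≈ y → y ∈ z → x ∈ z
∈-respˡ z x≈y (i , y≈) = i , ≈-trans _ _ _ x≈y y≈

el-∈ : ∀ x i → el x i ∈ x
el-∈ x i = i , ≈-refl (el x i)

≈⇒⊆ : ∀ x y → x ≈ y → ∀ i → el x i ∈ y
≈⇒⊆ (sup A f) (sup B g) (to , _) i = to i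

∈-respʳ : ∀ {x} y z → y ≈ z → x ∈ y → x ∈ z
∈-respʳ y z y≈z (i , x≈) = ∈-respˡ z x≈ (≈⇒⊆ y z y≈z i)

-- Recursion on trees: a member `f a` equal to `x` would again be a member of itself, and it is a
-- smaller tree.
∉-irrefl : ∀ x → ¬ x ∈ x
∉-irrefl (sup A f) (a , x≈fa) =
  ∉-irrefl (f a) (∈-respˡ (f a) (≈-sym _ _ x≈fa) (∈-respʳ (sup A f) (f a) x≈fa (a , x≈fa)))

numeral-∈ : ∀ {m n} → m ℕ.< n → numeral m ∈ numeral n
numeral-∈ {m} {suc n} (s≤s m≤n) with ℕ.m≤n⇒m<n∨m≡n m≤n
... | inj₁ m<n  = let (i , e) = numeral-∈ m<n in inj₁ i , e
... | inj₂ refl = inj₂ zero , ≈-refl (numeral m)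

numeral-injective : ∀ {m n} → numeral m ≈ numeral n → m ≡ n
numeral-injective {m} {n} e with ℕ.<-cmp m n
... | tri< m<n _ _ = contradiction (∈-respˡ (numeral n) (≈-sym _ _ e) (numeral-∈ m<n)) (∉-irrefl (numeral n))
... | tri≈ _ m≡n _ = m≡n
... | tri> _ _ n<m = contradiction (∈-respˡ (numeral m) e (numeral-∈ n<m)) (∉-irrefl (numeral m))

inclusion : ∀ x y → (∀ i → el x i ∈ y) → Injection ⟦ x ⟧ ⟦ y ⟧
inclusion x y sub = record
  { to        = λ i → proj₁ (sub i)
  ; cong      = λ {i} {j} e → ≈-trans _ _ _ (≈-sym _ _ (proj₂ (sub i)))
                                (≈-trans _ _ _ e (proj₂ (sub j)))
  ; injective = λ {i} {j} e → ≈-trans _ _ _ (proj₂ (sub i))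
                                (≈-trans _ _ _ e (≈-sym _ _ (proj₂ (sub j))))
  }

<ᶜ-respˡ : ∀ x y z → x ≈ y → x <ᶜ z → y <ᶜ z
<ᶜ-respˡ x y z x≈y (x≤z , z≰x) =
  Compose.injection y↣x x≤z ,
  λ z≤y → z≰x (Compose.injection z≤y y↣x)
  where y↣x = inclusion y x (≈⇒⊆ y x (≈-sym x y x≈y))

H-el : ∀ {θ x} → H θ x → ∀ i → H θ (el x i)
H-el {x = sup A f} (_ , h) = h

H-resp : ∀ θ x y → x ≈ y → H θ x → H θ y
H-resp θ (sup A f) (sup B g) e@(_ , from) (x<θ , h) =
  <ᶜ-respˡ (sup A f) (sup B g) θ e x<θ ,
  λ b → H-resp θ (f (proj₁ (from b))) (g b) (proj₂ (from b)) (h _)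

-- Each step function g i only depends on the index i of a i, so closure is
-- demanded for one index of each element of the range of a; otherwise
-- closing off could add uncountably many elements.

record ClosedUnder (K : V → Set) (p : V) {I : Set} (a : I → V) (g : I → ℕ → V) (x : V) : Set where
  field
    members  : ∀ i → K (el x i)
    infinite : Bijection (setoid ℕ) ⟦ x ⟧
    base     : p ∈ x
    step     : ∀ i → a i ∈ x → ∃[ i′ ] a i ≈ a i′ × (∀ k → g i′ k ∈ x)

-- The club of closed sets

module _ (em : Classical) (K : V → Set) (K-resp : ∀ x y → x ≈ y → K x → K y)
         (p : V) (Kp : K p) {I : Set} (a : I → V) (g : I → ℕ → V) (Kg : ∀ i k → K (g i k)) where

  open ClosedUnder

  private
    C = ClosedUnder K p a g

    onto : ∀ x (b : Bijection (setoid ℕ) ⟦ x ⟧) → ∀ i →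
           ∃[ n ] el x (Bijection.to b n) ≈ el x i
    onto x b i = proj₁ (Bijection.surjective b i) , proj₂ (Bijection.surjective b i) refl

    respects : ∀ x y → x ≈ y → C x → C y
    respects x y x≈y c = record
      { members  = λ j → let (i , e) = ≈⇒⊆ y x y≈x j in K-resp _ _ (≈-sym _ _ e) (members c i)
      ; infinite = Enumeration.bijection em ⟦ y ⟧ (λ n → proj₁ (x⊆y (Bijection.to (infinite c) n)))
          (λ j → let (i , e) = ≈⇒⊆ y x y≈x j ; (n , e′) = onto x (infinite c) i in
            n , ≈-trans _ _ _ (≈-sym _ _ (proj₂ (x⊆y _))) (≈-trans _ _ _ e′ (≈-sym _ _ e)))
          (Compose.injection (Bijection.injection (infinite c)) (inclusion x y x⊆y))
      ; base     = ∈-respʳ x y x≈y (base c)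
      ; step     = λ i ai∈y → let (i′ , e , s) = step c i (∈-respʳ y x y≈x ai∈y) in
          i′ , e , λ k → ∈-respʳ x y x≈y (s k)
      }
      where
      x⊆y = ≈⇒⊆ x y x≈y
      y≈x = ≈-sym x y x≈y

    -- Closing off in ω stages: row 0 of `val` lists `p` and the elements of `x`, and row `suc n`
    -- lists all values of the step functions at row `n`. Every row is a sequence, so the union
    -- stays countable.
    module Closure (x : V) (x-countable : x ∈[ K ]^ℵ₀) where
      -- Excluded middle fixes a single index for `v`, so each element contributes only a sequence
      -- of new ones. Outside the range of `a` the value defaults to `p`, which lies in `K`.
      apply : V → ℕ → V
      apply v k with em {P = ∃[ i ] v ≈ a i}
      ... | yes (i , _) = g i k
      ... | no _        = p

      apply-K : ∀ v k → K (apply v k)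
      apply-K v k with em {P = ∃[ i ] v ≈ a i}
      ... | yes (i , _) = Kg i k
      ... | no _        = Kp

      apply-step : ∀ i v → a i ≈ v → ∃[ i′ ] a i ≈ a i′ × (∀ k → apply v k ≡ g i′ k)
      apply-step i v e with em {P = ∃[ i ] v ≈ a i}
      ... | yes (i′ , e′) = i′ , ≈-trans _ _ _ e e′ , λ k → refl
      ... | no ¬found     = contradiction (i , ≈-sym _ _ e) ¬found

      val : ℕ → ℕ → V
      val zero zero    = p
      val zero (suc m) = el x (Bijection.to (proj₂ x-countable) m)
      val (suc n) m    = uncurry (λ j → apply (val n j)) (unpair m)

      val-K : ∀ n m → K (val n m)
      val-K zero zero    = Kp
      val-K zero (suc m) = proj₁ x-countable _ (el-∈ x _)
      val-K (suc n) m    = apply-K _ _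

      y : V
      y = sup (ℕ × ℕ) (uncurry val)

      x⊆y : ∀ i → el x i ∈ y
      x⊆y i = let (n , e) = onto x (proj₂ x-countable) i in (0 , suc n) , ≈-sym _ _ e

      closed : C y
      closed = record
        { members  = λ (n , m) → val-K n m
        ; infinite = Enumeration.bijection em ⟦ y ⟧ unpair
            (λ (n , m) → let (k , e) = unpair-surjective n m in
              k , subst (λ z → uncurry val z ≈ val n m) (sym e) (≈-refl _))
            -- The closure is infinite because it contains the infinite set `x`.
            (Compose.injection (Bijection.injection (proj₂ x-countable)) (inclusion x y x⊆y))
        ; base     = (0 , 0) , ≈-refl p
        ; step     = λ i ((n , m) , e) → let (i′ , e′ , s) = apply-step i (val n m) e in
            i′ , e′ , λ k → let (j , ej) = unpair-surjective m k in
              (suc n , j) , subst (_≈ uncurry (λ j → apply (val n j)) (unpair j)) (s k)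
                (subst (λ z → apply (val n m) k ≈ uncurry (λ j → apply (val n j)) z) (sym ej) (≈-refl _))
        }

    ⋃-closed : (s : ℕ → V) → (∀ n → C (s n)) → C (⋃ₙ s)
    ⋃-closed s c = record
      { members  = λ (n , i) → members (c n) i
      ; infinite = Enumeration.bijection em ⟦ ⋃ₙ s ⟧
          (λ k → let (n , m) = unpair k in n , Bijection.to (infinite (c n)) m)
          (λ (n , i) → let (m , e) = onto (s n) (infinite (c n)) i ; (k , ek) = unpair-surjective n m in
            k , subst (λ z → el (s (proj₁ z)) (Bijection.to (infinite (c (proj₁ z))) (proj₂ z)) ≈ el (s n) i)
                  (sym ek) e)
          (Compose.injection (Bijection.injection (infinite (c 0)))
            (inclusion (s 0) (⋃ₙ s) (λ i → (0 , i) , ≈-refl _)))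
      ; base     = let (i , e) = base (c 0) in (0 , i) , e
      ; step     = λ i ((n , j) , e) → let (i′ , e′ , h) = step (c n) i (j , e) in
          i′ , e′ , λ k → let (l , el) = h k in (n , l) , el
      }

  closedUnder-isClub : IsClub K (ClosedUnder K p a g)
  closedUnder-isClub = record
    { respects  = respects
    ; countable = λ x c → (λ z (i , z≈) → K-resp _ _ (≈-sym _ _ z≈) (members c i)) , infinite c
    ; unbounded = λ x xc → Closure.y x xc , Closure.closed x xc ,
        λ z (i , z≈) → ∈-respˡ (Closure.y x xc) z≈ (Closure.x⊆y x xc i)
    ; closed    = λ s c _ → ⋃-closed s c
    }

-- Forcing

module ForcingLogic (em : ExcludedMiddle (lsuc 0ℓ)) (P L : V) (poset : Forcing.IsPoset P L) where
  open Forcing P L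
  open Interpretation forcing
  open Properties forcing

  ≤-refl : ∀ {p : Condition} → p ≤ p
  ≤-refl {p} = IsPartialOrder.reflexive (proj₂ poset) (≈-refl (el P p))

  ≤-trans : ∀ {p q r : Condition} → p ≤ q → q ≤ r → p ≤ r
  ≤-trans = IsPartialOrder.trans (proj₂ poset)

  ≤-reflexive : ∀ {p q : Condition} → el P p ≈ el P q → p ≤ q
  ≤-reflexive = IsPartialOrder.reflexive (proj₂ poset)

  index : Name → Set
  index (sup A σ c) = A

  member : (x : Name) → index x → Name
  member (sup A σ c) = σ

  label : (x : Name) → index x → Condition
  label (sup A σ c) = c

  -- `_⊩_∈̇_` computes only when its right-hand name is a constructor term; `index`, `member` and
  -- `label` express its clause for arbitrary names.
  ⊩∈-unfold : ∀ {p : Condition} (x y : Name) → p ⊩ x ∈̇ y →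
    DenseBelow p λ r → Σ[ b ∈ index y ] r ≤ label y b × r ⊩ x ≐ member y b
  ⊩∈-unfold x (sup B τ d) h = h

  ⊩∈-fold : ∀ {p : Condition} (x y : Name) →
    DenseBelow p (λ r → Σ[ b ∈ index y ] r ≤ label y b × r ⊩ x ≐ member y b) → p ⊩ x ∈̇ y
  ⊩∈-fold x (sup B τ d) h = h

  ⊩≐-mono : ∀ {p q : Condition} (x y : Name) → q ≤ p → p ⊩ x ≐ y → q ⊩ x ≐ y
  ⊩≐-mono (sup A σ c) (sup B τ d) q≤p (to , from) =
    (λ a r r≤q → to a r (≤-trans r≤q q≤p)) , (λ b r r≤q → from b r (≤-trans r≤q q≤p))

  -- Both clauses only ask for some condition below a given `r`, so `r` may first be strengthened to
  -- one that forces the equality.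
  ⊩≐-local : ∀ {p : Condition} (x y : Name) → DenseBelow p (λ q → q ⊩ x ≐ y) → p ⊩ x ≐ y
  ⊩≐-local (sup A σ c) (sup B τ d) h =
    (λ a q q≤p q≤ r r≤q →
      let (s , s≤r , e) = h r (≤-trans r≤q q≤p)
          (t , t≤s , w) = proj₁ e a s ≤-refl (≤-trans s≤r (≤-trans r≤q q≤)) s ≤-refl
      in t , ≤-trans t≤s s≤r , w) ,
    (λ b q q≤p q≤ r r≤q →
      let (s , s≤r , e) = h r (≤-trans r≤q q≤p)
          (t , t≤s , w) = proj₂ e b s ≤-refl (≤-trans s≤r (≤-trans r≤q q≤)) s ≤-refl
      in t , ≤-trans t≤s s≤r , w)

  ⊩≐-refl : ∀ {p : Condition} (x : Name) → p ⊩ x ≐ x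
  ⊩≐-refl (sup A σ c) =
    (λ a q _ q≤ r r≤q → r , ≤-refl , a , ≤-trans r≤q q≤ , ⊩≐-refl (σ a)) ,
    (λ a q _ q≤ r r≤q → r , ≤-refl , a , ≤-trans r≤q q≤ , ⊩≐-refl (σ a))

  ⊩≐-sym : ∀ {p : Condition} (x y : Name) → p ⊩ x ≐ y → p ⊩ y ≐ x
  ⊩≐-sym (sup A σ c) (sup B τ d) (to , from) =
    (λ b q q≤p q≤ r r≤q →
      let (s , s≤r , a , s≤ , e) = from b q q≤p q≤ r r≤q
      in s , s≤r , a , s≤ , ⊩≐-sym (σ a) (τ b) e) ,
    (λ a q q≤p q≤ r r≤q →
      let (s , s≤r , b , s≤ , e) = to a q q≤p q≤ r r≤q
      in s , s≤r , b , s≤ , ⊩≐-sym (σ a) (τ b) e)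

  ⊩≐-trans : ∀ {p : Condition} (x y z : Name) → p ⊩ x ≐ y → p ⊩ y ≐ z → p ⊩ x ≐ z
  ⊩≐-trans (sup A σ c) (sup B τ d) (sup C υ e) (to₁ , from₁) (to₂ , from₂) =
    (λ a q q≤p q≤ r r≤q →
      let (s , s≤r , b , s≤ , eq₀₁) = to₁ a q q≤p q≤ r r≤q
          (t , t≤s , i , t≤ , eq₀₂) =
            to₂ b s (≤-trans s≤r (≤-trans r≤q q≤p)) s≤ s ≤-refl
      in t , ≤-trans t≤s s≤r , i , t≤ ,
         ⊩≐-trans (σ a) (τ b) (υ i) (⊩≐-mono (σ a) (τ b) t≤s eq₀₁) eq₀₂) ,
    (λ i q q≤p q≤ r r≤q →
      let (s , s≤r , b , s≤ , eq₀₁) = from₂ i q q≤p q≤ r r≤q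
          (t , t≤s , a , t≤ , eq₀₂) =
            from₁ b s (≤-trans s≤r (≤-trans r≤q q≤p)) s≤ s ≤-refl
      in t , ≤-trans t≤s s≤r , a , t≤ ,
         ⊩≐-trans (σ a) (τ b) (υ i) eq₀₂ (⊩≐-mono (τ b) (υ i) t≤s eq₀₁))

  -- Every formula is forced by p as soon as it is forced densely below p, so
  -- when the goal is a formula one may pass to stronger conditions.

  Monotone : Ω → Set₁
  Monotone φ = ∀ {p q : Condition} → q ≤ p → φ p → φ q

  Densely : Ω → Ω
  Densely φ p = ∀ (q : Condition) → q ≤ p → Σ[ r ∈ Condition ] r ≤ q × φ r

  record Regular (φ : Ω) : Set₁ where
    field
      mono  : Monotone φ
      local : ∀ {p : Condition} → Densely φ p → φ p

  open Regular

  by-density : ∀ {χ φ : Ω} {p : Condition} → Regular χ → Densely φ p → (∀ (q : Condition) → q ≤ p → φ q → χ q) → χ p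
  by-density R d k = local R λ q q≤p →
    let (r , r≤q , φr) = d q q≤p in r , r≤q , k r (≤-trans r≤q q≤p) φr

  ≐-regular : ∀ (x y : Name) → Regular (x ≐ y)
  ≐-regular x y = record
    { mono  = λ q≤p (lift e) → lift (⊩≐-mono x y q≤p e)
    ; local = λ d → lift (⊩≐-local x y λ q q≤p →
        let (r , r≤q , lift e) = d q q≤p in r , r≤q , e)
    }

  ∈-regular : ∀ (x y : Name) → Regular (x ∈̇ y)
  ∈-regular x y = record
    { mono  = λ q≤p (lift h) → lift (⊩∈-fold x y λ r r≤q →
        ⊩∈-unfold x y h r (≤-trans r≤q q≤p))
    ; local = λ d → lift (⊩∈-fold x y λ q q≤p →
        let (r , r≤q , lift h) = d q q≤p
            (s , s≤r , w)      = ⊩∈-unfold x y h r ≤-refl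
        in s , ≤-trans s≤r r≤q , w)
    }

  ≐-refl : ∀ (x : Name) {p : Condition} → (x ≐ x) p
  ≐-refl x = lift (⊩≐-refl x)

  ≐-sym : ∀ (x y : Name) {p : Condition} → (x ≐ y) p → (y ≐ x) p
  ≐-sym x y (lift e) = lift (⊩≐-sym x y e)

  ≐-trans : ∀ (x y z : Name) {p : Condition} → (x ≐ y) p → (y ≐ z) p → (x ≐ z) p
  ≐-trans x y z (lift e) (lift f) = lift (⊩≐-trans x y z e f)

  member-∈ : ∀ (y : Name) (b : index y) {p : Condition} → p ≤ label y b → (member y b ∈̇ y) p
  member-∈ y b p≤ = lift (⊩∈-fold (member y b) y λ q q≤p →
    q , ≤-refl , b , ≤-trans q≤p p≤ , ⊩≐-refl (member y b))

  -- A membership supplies a matching member only densely often. As `χ` is regular, the argument may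
  -- proceed as if one were at hand; the other `case-` rules have the same purpose.
  case-∈ : ∀ {χ : Ω} {p : Condition} (x y : Name) → Regular χ → (x ∈̇ y) p →
    (∀ (q : Condition) → q ≤ p → (b : index y) → q ≤ label y b → (x ≐ member y b) q → χ q) → χ p
  case-∈ x y R (lift h) k = local R λ q q≤p →
    let (r , r≤q , b , r≤ , e) = ⊩∈-unfold x y h q q≤p
    in r , r≤q , k r (≤-trans r≤q q≤p) b r≤ (lift e)

  ∈-congˡ : ∀ (x x′ y : Name) {p : Condition} → (x ≐ x′) p → (x ∈̇ y) p → (x′ ∈̇ y) p
  ∈-congˡ x x′ y (lift e) (lift h) = lift (⊩∈-fold x′ y λ q q≤p →
    let (r , r≤q , b , r≤ , e′) = ⊩∈-unfold x y h q q≤p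
    in r , r≤q , b , r≤ ,
       ⊩≐-trans x′ x (member y b) (⊩≐-mono x′ x (≤-trans r≤q q≤p) (⊩≐-sym x x′ e)) e′)

  private
    ⊩≐-to : ∀ {p : Condition} (y y′ : Name) → p ⊩ y ≐ y′ → ∀ (b : index y) (q : Condition) → q ≤ p → q ≤ label y b → q ⊩ member y b ∈̇ y′
    ⊩≐-to (sup B τ d) (sup C υ e) (to , _) b q q≤p q≤ = to b q q≤p q≤

    -- The second clause of `_⊩_≐_` keeps the members of the left name on the left, unlike the
    -- membership hypothesis; hence the use of symmetry.
    ⊩≐-intro : ∀ {p : Condition} (y y′ : Name) →
      (∀ (b : index y) (q : Condition) → q ≤ p → q ≤ label y b → q ⊩ member y b ∈̇ y′) →
      (∀ (b : index y′) (q : Condition) → q ≤ p → q ≤ label y′ b → q ⊩ member y′ b ∈̇ y) → p ⊩ y ≐ y′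
    ⊩≐-intro (sup B τ d) (sup C υ e) to from = to , λ i q q≤p q≤ r r≤q →
      let (s , s≤r , b , s≤ , eq₀) = from i q q≤p q≤ r r≤q
      in s , s≤r , b , s≤ , ⊩≐-sym (υ i) (τ b) eq₀

  ∈-congʳ : ∀ (x y y′ : Name) {p : Condition} → (y ≐ y′) p → (x ∈̇ y) p → (x ∈̇ y′) p
  ∈-congʳ x y y′ (lift e) h = case-∈ x y (∈-regular x y′) h λ q q≤p b q≤ eq₀ →
    ∈-congˡ (member y b) x y′ (≐-sym x (member y b) eq₀) (lift (⊩≐-to y y′ e b q q≤p q≤))

  ≐-ext : ∀ (x y : Name) {p : Condition} → (∀ (z : Name) (q : Condition) → q ≤ p → (z ∈̇ x) q → (z ∈̇ y) q) →
    (∀ (z : Name) (q : Condition) → q ≤ p → (z ∈̇ y) q → (z ∈̇ x) q) → (x ≐ y) p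
  ≐-ext x y to from = lift (⊩≐-intro x y
    (λ b q q≤p q≤ → lower (to (member x b) q q≤p (member-∈ x b q≤)))
    (λ b q q≤p q≤ → lower (from (member y b) q q≤p (member-∈ y b q≤))))

  -- Forcing of compound formulas

  ¬-mono : ∀ {φ : Ω} → Monotone (¬̇ φ)
  ¬-mono q≤p h r r≤q = h r (≤-trans r≤q q≤p)

  ¬-regular : ∀ {φ : Ω} → Monotone φ → Regular (¬̇ φ)
  ¬-regular m = record
    { mono  = ¬-mono
    ; local = λ d q q≤p φq → let (r , r≤q , h) = d q q≤p in h r ≤-refl (m r≤q φq)
    }

  ∧-regular : ∀ {φ ψ : Ω} → Regular φ → Regular ψ → Regular (φ ∧̇ ψ)
  ∧-regular R S = record
    { mono  = λ q≤p (a , b) → mono R q≤p a , mono S q≤p b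
    ; local = λ d → by-density R d (λ _ _ → proj₁) , by-density S d (λ _ _ → proj₂)
    }

  ∀-regular : ∀ {φ : Name → Ω} → (∀ (x : Name) → Regular (φ x)) → Regular (∀̇ φ)
  ∀-regular R = record
    { mono  = λ q≤p h x → mono (R x) q≤p (h x)
    ; local = λ d x → by-density (R x) d (λ _ _ h → h x)
    }

  ∃-regular : ∀ {φ : Name → Ω} → Regular (∃̇ φ)
  ∃-regular = ¬-regular λ q≤p h x → ¬-mono q≤p (h x)

  ∨-regular : ∀ {φ ψ : Ω} → Regular (φ ∨̇ ψ)
  ∨-regular = ¬-regular λ q≤p (h , k) → ¬-mono q≤p h , ¬-mono q≤p k

  ⇒-regular : ∀ {φ ψ : Ω} → Monotone φ → Regular (φ ⇒̇ ψ)
  ⇒-regular m = ¬-regular λ q≤p (a , h) → m q≤p a , ¬-mono q≤p h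

  ⇔-regular : ∀ {φ ψ : Ω} → Monotone φ → Monotone ψ → Regular (φ ⇔̇ ψ)
  ⇔-regular m n = ∧-regular (⇒-regular m) (⇒-regular n)

  ∀∈-regular : ∀ (a : Name) {φ : Name → Ω} → Regular (∀∈ a φ)
  ∀∈-regular a = ∀-regular λ x → ⇒-regular (mono (∈-regular x a))

  ⇒-intro : ∀ {φ ψ : Ω} {p : Condition} → (∀ (q : Condition) → q ≤ p → φ q → ψ q) → (φ ⇒̇ ψ) p
  ⇒-intro h q q≤p (a , ¬b) = ¬b q ≤-refl (h q q≤p a)

  -- Unfolded, the implication says that no condition below `p` forces both `φ` and `¬̇ ψ`. A
  -- condition without an extension forcing `ψ` would itself force `¬̇ ψ`, so `ψ` is forced densely
  -- below `p`, and hence by `p`.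
  ⇒-elim : ∀ {φ ψ : Ω} {p : Condition} → Monotone φ → Regular ψ → (φ ⇒̇ ψ) p → φ p → ψ p
  ⇒-elim {φ} {ψ} {p} m R h a = local R dense
    where
    dense : Densely ψ p
    dense q q≤p with em {P = Σ[ r ∈ Condition ] r ≤ q × ψ r}
    ... | yes found = found
    ... | no ¬found = ⊥-elim (h q q≤p (m q≤p a , λ r r≤q b → ¬found (r , r≤q , b)))

  ⇔-to : ∀ {φ ψ : Ω} {p : Condition} → Monotone φ → Regular ψ → (φ ⇔̇ ψ) p → φ p → ψ p
  ⇔-to m R (h , _) = ⇒-elim m R h

  ⇔-from : ∀ {φ ψ : Ω} {p : Condition} → Regular φ → Monotone ψ → (φ ⇔̇ ψ) p → ψ p → φ p
  ⇔-from R m (_ , h) = ⇒-elim m R h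

  ∨-introˡ : ∀ {φ ψ : Ω} {p : Condition} → Monotone φ → φ p → (φ ∨̇ ψ) p
  ∨-introˡ m a q q≤p (¬a , _) = ¬a q ≤-refl (m q≤p a)

  ∨-introʳ : ∀ {φ ψ : Ω} {p : Condition} → Monotone ψ → ψ p → (φ ∨̇ ψ) p
  ∨-introʳ m b q q≤p (_ , ¬b) = ¬b q ≤-refl (m q≤p b)

  -- As for implication: if no extension of `q` forced `χ`, then `q` would force the negations of
  -- both disjuncts. `case-∃` does the same with all instances.
  case-∨ : ∀ {χ φ ψ : Ω} {p : Condition} → Regular χ → (φ ∨̇ ψ) p →
    (∀ (q : Condition) → q ≤ p → φ q → χ q) → (∀ (q : Condition) → q ≤ p → ψ q → χ q) → χ p
  case-∨ {χ} {φ} {ψ} {p} R h k l = local R dense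
    where
    dense : Densely χ p
    dense q q≤p with em {P = Σ[ r ∈ Condition ] r ≤ q × χ r}
    ... | yes found = found
    ... | no ¬found = ⊥-elim (h q q≤p
      ( (λ r r≤q a → ¬found (r , r≤q , k r (≤-trans r≤q q≤p) a))
      , (λ r r≤q b → ¬found (r , r≤q , l r (≤-trans r≤q q≤p) b))))

  ∃-intro : ∀ {φ : Name → Ω} {p : Condition} (x : Name) → Monotone (φ x) → φ x p → (∃̇ φ) p
  ∃-intro x m a q q≤p h = h x q ≤-refl (m q≤p a)

  case-∃ : ∀ {χ : Ω} {φ : Name → Ω} {p : Condition} → Regular χ → (∃̇ φ) p →
    (∀ (q : Condition) → q ≤ p → ∀ (x : Name) → φ x q → χ q) → χ p
  case-∃ {χ} {φ} {p} R h k = local R dense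
    where
    dense : Densely χ p
    dense q q≤p with em {P = Σ[ r ∈ Condition ] r ≤ q × χ r}
    ... | yes found = found
    ... | no ¬found = ⊥-elim (h q q≤p
      λ x r r≤q a → ¬found (r , r≤q , k r (≤-trans r≤q q≤p) x a))

  ∀∈-intro : ∀ (a : Name) {φ : Name → Ω} {p : Condition} →
    (∀ (x : Name) (q : Condition) → q ≤ p → (x ∈̇ a) q → φ x q) → (∀∈ a φ) p
  ∀∈-intro a h x = ⇒-intro (h x)

  ∀∈-elim : ∀ (a : Name) {φ : Name → Ω} {p : Condition} (x : Name) → Regular (φ x) → (∀∈ a φ) p → (x ∈̇ a) p → φ x p
  ∀∈-elim a x R h = ⇒-elim (mono (∈-regular x a)) R (h x)

  ∃∈-intro : ∀ (a : Name) {φ : Name → Ω} {p : Condition} (x : Name) → Monotone (φ x) → (x ∈̇ a) p → φ x p → (∃∈ a φ) p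
  ∃∈-intro a x m x∈a φx =
    ∃-intro x (λ q≤p (h , k) → mono (∈-regular x a) q≤p h , m q≤p k) (x∈a , φx)

  ⊆-elim : ∀ (a b : Name) {p : Condition} (x : Name) → (a ⊆̇ b) p → (x ∈̇ a) p → (x ∈̇ b) p
  ⊆-elim a b x = ∀∈-elim a x (∈-regular x b)

  -- Pairs

  -- Both members are labelled with every condition, as in `check`, because `P` need not have a
  -- largest element.
  doubleton : Name → Name → Name
  doubleton a b = sup (Bool × Condition) (λ (i , _) → if i then a else b) proj₂

  ∈-doubletonˡ : ∀ (a b : Name) {p : Condition} → (a ∈̇ doubleton a b) p
  ∈-doubletonˡ a b {p} = member-∈ (doubleton a b) (true , p) ≤-refl

  ∈-doubletonʳ : ∀ (a b : Name) {p : Condition} → (b ∈̇ doubleton a b) p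
  ∈-doubletonʳ a b {p} = member-∈ (doubleton a b) (false , p) ≤-refl

  case-doubleton : ∀ {χ : Ω} {p : Condition} (x a b : Name) → Regular χ → (x ∈̇ doubleton a b) p →
    (∀ (q : Condition) → q ≤ p → (x ≐ a) q → χ q) → (∀ (q : Condition) → q ≤ p → (x ≐ b) q → χ q) → χ p
  case-doubleton x a b R h k l = case-∈ x (doubleton a b) R h λ
    { q q≤p (true , _) _ e → k q q≤p e ; q q≤p (false , _) _ e → l q q≤p e }

  IsDoubleton-regular : ∀ (w a b : Name) → Regular (IsDoubleton w a b)
  IsDoubleton-regular w a b = ∀-regular λ y →
    ⇔-regular (mono (∈-regular y w)) (mono ∨-regular)

  IsPair-regular : ∀ (z a b : Name) → Regular (IsPair z a b)
  IsPair-regular z a b = ∀-regular λ w →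
    ⇔-regular (mono (∈-regular w z)) (mono ∨-regular)

  doubleton-isDoubleton : ∀ (a b : Name) {p : Condition} → IsDoubleton (doubleton a b) a b p
  doubleton-isDoubleton a b y =
    ⇒-intro (λ q _ h → case-doubleton y a b ∨-regular h
      (λ _ _ → ∨-introˡ (mono (≐-regular y a)))
      (λ _ _ → ∨-introʳ (mono (≐-regular y b)))) ,
    ⇒-intro (λ q _ h → case-∨ (∈-regular y (doubleton a b)) h
      (λ _ _ e → ∈-congˡ a y _ (≐-sym y a e) (∈-doubletonˡ a b))
      (λ _ _ e → ∈-congˡ b y _ (≐-sym y b e) (∈-doubletonʳ a b)))

  module _ (w a b : Name) {p} (h : IsDoubleton w a b p) where
    IsDoubleton-∈ˡ : (a ∈̇ w) p
    IsDoubleton-∈ˡ = ⇔-from (∈-regular a w) (mono ∨-regular) (h a)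
      (∨-introˡ (mono (≐-regular a a)) (≐-refl a))

    IsDoubleton-cases : ∀ (y : Name) → (y ∈̇ w) p → (y ≐ a ∨̇ y ≐ b) p
    IsDoubleton-cases y = ⇔-to (mono (∈-regular y w)) ∨-regular (h y)

    IsDoubleton-≐ : (w ≐ doubleton a b) p
    IsDoubleton-≐ = ≐-ext w (doubleton a b)
      (λ y q q≤p y∈w → ⇔-from (∈-regular y (doubleton a b)) (mono ∨-regular) (doubleton-isDoubleton a b y)
        (⇔-to (mono (∈-regular y w)) ∨-regular (mono (IsDoubleton-regular w a b) q≤p h y) y∈w))
      (λ y q q≤p y∈d → ⇔-from (∈-regular y w) (mono ∨-regular) (mono (IsDoubleton-regular w a b) q≤p h y)
        (⇔-to (mono (∈-regular y (doubleton a b))) ∨-regular (doubleton-isDoubleton a b y) y∈d))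

  IsDoubleton-resp : ∀ (w w′ a b : Name) {p : Condition} → (w ≐ w′) p → IsDoubleton w a b p → IsDoubleton w′ a b p
  IsDoubleton-resp w w′ a b {p} e h y =
    ⇒-intro (λ q q≤p y∈w′ → ⇔-to (mono (∈-regular y w)) ∨-regular
      (mono (IsDoubleton-regular w a b) q≤p h y)
      (∈-congʳ y w′ w (≐-sym w w′ (mono (≐-regular w w′) q≤p e)) y∈w′)) ,
    ⇒-intro (λ q q≤p d → ∈-congʳ y w w′ (mono (≐-regular w w′) q≤p e)
      (⇔-from (∈-regular y w) (mono ∨-regular) (mono (IsDoubleton-regular w a b) q≤p h y) d))

  pair : Name → Name → Name
  pair a b = doubleton (doubleton a a) (doubleton a b)

  pair-isPair : ∀ (a b : Name) {p : Condition} → IsPair (pair a b) a b p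
  pair-isPair a b w =
    ⇒-intro (λ q _ h → case-doubleton w aa ab ∨-regular h
      (λ _ _ e → ∨-introˡ (mono (IsDoubleton-regular w a a))
        (IsDoubleton-resp aa w a a (≐-sym w aa e) (doubleton-isDoubleton a a)))
      (λ _ _ e → ∨-introʳ (mono (IsDoubleton-regular w a b))
        (IsDoubleton-resp ab w a b (≐-sym w ab e) (doubleton-isDoubleton a b)))) ,
    ⇒-intro (λ q _ h → case-∨ (∈-regular w (pair a b)) h
      (λ _ _ d → ∈-congˡ aa w _ (≐-sym w aa (IsDoubleton-≐ w a a d)) (∈-doubletonˡ aa ab))
      (λ _ _ d → ∈-congˡ ab w _ (≐-sym w ab (IsDoubleton-≐ w a b d)) (∈-doubletonʳ aa ab)))
    where
    aa = doubleton a a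
    ab = doubleton a b

  module _ (z a b a′ b′ : Name) {p} (h : IsPair z a b p) (h′ : IsPair z a′ b′ p) where
    -- The singleton of `a` belongs to `z`, so it is the singleton of `a′` or the doubleton of `a′`
    -- and `b′`; either way `a′` is one of its members.
    IsPair-injectiveˡ : (a ≐ a′) p
    IsPair-injectiveˡ = case-∨ (≐-regular a a′)
      (⇔-to (mono (∈-regular aa z)) ∨-regular (h′ aa)
        (⇔-from (∈-regular aa z) (mono ∨-regular) (h aa)
          (∨-introˡ (mono (IsDoubleton-regular aa a a)) (doubleton-isDoubleton a a))))
      (λ q _ d → from-a′∈ (IsDoubleton-∈ˡ aa a′ a′ d))
      (λ q _ d → from-a′∈ (IsDoubleton-∈ˡ aa a′ b′ d))
      where
      aa = doubleton a a
      from-a′∈ : ∀ {q : Condition} → (a′ ∈̇ aa) q → (a ≐ a′) q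
      from-a′∈ i = case-doubleton a′ a a (≐-regular a a′) i
        (λ _ _ → ≐-sym a′ a) (λ _ _ → ≐-sym a′ a)

    -- The same argument for the doubleton of `a` and `b`, of which `b` is a member.
    IsPair-second : (b ≐ a′ ∨̇ b ≐ b′) p
    IsPair-second = case-∨ ∨-regular
      (⇔-to (mono (∈-regular ab z)) ∨-regular (h′ ab)
        (⇔-from (∈-regular ab z) (mono ∨-regular) (h ab)
          (∨-introʳ (mono (IsDoubleton-regular ab a b)) (doubleton-isDoubleton a b))))
      (λ q _ d → case-∨ ∨-regular (IsDoubleton-cases ab a′ a′ d b (∈-doubletonʳ a b))
        (λ _ _ → ∨-introˡ (mono (≐-regular b a′))) (λ _ _ → ∨-introˡ (mono (≐-regular b a′))))
      (λ q _ d → IsDoubleton-cases ab a′ b′ d b (∈-doubletonʳ a b))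
      where ab = doubleton a b

  -- If `b` equals `a′`, then by symmetry `b′` equals `a` or `b`, and in the first case `b`, `a′`,
  -- `a` and `b′` all coincide.
  IsPair-injectiveʳ : ∀ (z a b a′ b′ : Name) {p : Condition} → IsPair z a b p → IsPair z a′ b′ p → (b ≐ b′) p
  IsPair-injectiveʳ z a b a′ b′ h h′ =
    case-∨ (≐-regular b b′) (IsPair-second z a b a′ b′ h h′)
      (λ q q≤p b≐a′ → case-∨ (≐-regular b b′)
        (mono ∨-regular q≤p (IsPair-second z a′ b′ a b h′ h))
        (λ r r≤q b′≐a → ≐-trans b a′ b′ (mono (≐-regular b a′) r≤q b≐a′)
          (≐-trans a′ a b′
            (mono (≐-regular a′ a) (≤-trans r≤q q≤p) (IsPair-injectiveˡ z a′ b′ a b h′ h))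
            (≐-sym b′ a b′≐a)))
        (λ _ _ → ≐-sym b′ b))
      (λ _ _ → id)

  IsPair-resp : ∀ (z z′ a b : Name) {p : Condition} → (z ≐ z′) p → IsPair z a b p → IsPair z′ a b p
  IsPair-resp z z′ a b e h w =
    ⇒-intro (λ q q≤p w∈z′ → ⇔-to (mono (∈-regular w z)) ∨-regular
      (mono (IsPair-regular z a b) q≤p h w)
      (∈-congʳ w z′ z (≐-sym z z′ (mono (≐-regular z z′) q≤p e)) w∈z′)) ,
    ⇒-intro (λ q q≤p d → ∈-congʳ w z z′ (mono (≐-regular z z′) q≤p e)
      (⇔-from (∈-regular w z) (mono ∨-regular) (mono (IsPair-regular z a b) q≤p h w) d))

  case-∃∈ : ∀ {χ : Ω} (a : Name) {φ : Name → Ω} {p : Condition} → Regular χ → (∃∈ a φ) p →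
    (∀ (q : Condition) → q ≤ p → (x : Name) → (x ∈̇ a) q → φ x q → χ q) → χ p
  case-∃∈ a R h k = case-∃ R h λ q q≤p x (x∈a , φx) → k q q≤p x x∈a φx

  doubleton-congʳ : ∀ (a b b′ : Name) {p : Condition} → (b ≐ b′) p → (doubleton a b ≐ doubleton a b′) p
  doubleton-congʳ a b b′ {p} b≐b′ = ≐-ext (doubleton a b) (doubleton a b′)
    (λ z q q≤p h → ⊆-half b b′ z q (mono (≐-regular b b′) q≤p b≐b′) h)
    (λ z q q≤p h → ⊆-half b′ b z q (≐-sym b b′ (mono (≐-regular b b′) q≤p b≐b′)) h)
    where
    ⊆-half : ∀ (b b′ z : Name) (q : Condition) → (b ≐ b′) q →
      (z ∈̇ doubleton a b) q → (z ∈̇ doubleton a b′) q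
    ⊆-half b b′ z q e h = case-doubleton z a b (∈-regular z (doubleton a b′)) h
      (λ r r≤q z≐a → ∈-congˡ a z (doubleton a b′) (≐-sym z a z≐a) (∈-doubletonˡ a b′))
      (λ r r≤q z≐b → ∈-congˡ b′ z (doubleton a b′)
        (≐-sym z b′ (≐-trans z b b′ z≐b (mono (≐-regular b b′) r≤q e))) (∈-doubletonʳ a b′))

  pair-congʳ : ∀ (a b b′ : Name) {p : Condition} → (b ≐ b′) p → (pair a b ≐ pair a b′) p
  pair-congʳ a b b′ e = doubleton-congʳ (doubleton a a) (doubleton a b) (doubleton a b′)
    (doubleton-congʳ a b b′ e)

  -- Check names

  ⊩check-cong : ∀ (x y : V) → x ≈ y → ∀ {p : Condition} → p ⊩ check x ≐ check y
  ⊩check-cong (sup A f) (sup B g) (to , from) =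
    (λ (a , c) q _ q≤c r r≤q →
      r , ≤-refl , (proj₁ (to a) , c) , ≤-trans r≤q q≤c ,
      ⊩check-cong (f a) (g (proj₁ (to a))) (proj₂ (to a))) ,
    (λ (b , c) q _ q≤c r r≤q →
      r , ≤-refl , (proj₁ (from b) , c) , ≤-trans r≤q q≤c ,
      ⊩check-cong (f (proj₁ (from b))) (g b) (proj₂ (from b)))

  check-cong : ∀ (x y : V) {p : Condition} → x ≈ y → (check x ≐ check y) p
  check-cong x y x≈y = lift (⊩check-cong x y x≈y)

  check-∈ : ∀ (x : V) (i : Ix x) {p : Condition} → (check (el x i) ∈̇ check x) p
  check-∈ (sup A f) i {p} = member-∈ (check (sup A f)) (i , p) ≤-refl

  case-check : ∀ {χ : Ω} {p : Condition} (ν : Name) (x : V) → Regular χ → (ν ∈̇ check x) p →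
    (∀ (q : Condition) → q ≤ p → (i : Ix x) → (ν ≐ check (el x i)) q → χ q) → χ p
  case-check ν (sup A f) R h k =
    case-∈ ν (check (sup A f)) R h λ q q≤p (i , _) _ e → k q q≤p i e

  -- Members of check names carry every label, in particular `p`, so the clauses for equality can be
  -- used at `p` itself. The partner that they give is an index from the ground model, and induction
  -- applies to it.
  ⊩check-reflect : ∀ (x y : V) {p : Condition} → p ⊩ check x ≐ check y → x ≈ y
  ⊩check-reflect (sup A f) (sup B g) {p} (to , from) =
    (λ a → let (_ , _ , (b , _) , _ , e) = to (a , p) p ≤-refl ≤-refl p ≤-refl
           in b , ⊩check-reflect (f a) (g b) e) ,
    (λ b → let (_ , _ , (a , _) , _ , e) = from (b , p) p ≤-refl ≤-refl p ≤-refl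
           in a , ⊩check-reflect (f a) (g b) e)

  check-reflect-≐ : ∀ (x y : V) {p : Condition} → (check x ≐ check y) p → x ≈ y
  check-reflect-≐ x y (lift e) = ⊩check-reflect x y e

  check-reflect-∈ : ∀ (x y : V) {p : Condition} → (check x ∈̇ check y) p → x ∈ y
  check-reflect-∈ x (sup B g) {p} (lift h) =
    let (_ , _ , (b , _) , _ , e) = h p ≤-refl in b , ⊩check-reflect x (g b) e

  -- The ordinal ω

  IsSuccessor-regular : ∀ (m n : Name) → Regular (IsSuccessor m n)
  IsSuccessor-regular m n = ∀-regular λ y → ⇔-regular (mono (∈-regular y m)) (mono ∨-regular)

  IsInductive-regular : ∀ (v : Name) → Regular (IsInductive v)
  IsInductive-regular v = ∧-regular ∃-regular (∀∈-regular v)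

  IsEmpty-regular : ∀ (z : Name) → Regular (IsEmpty z)
  IsEmpty-regular z = ∀-regular λ y → ¬-regular (mono (∈-regular y z))

  check-0-isEmpty : ∀ {p : Condition} → IsEmpty (check (numeral 0)) p
  check-0-isEmpty y q _ (lift h) with h q ≤-refl
  ... | _ , _ , (() , _) , _

  check-isSuccessor : ∀ (x : V) (ν : Name) {p : Condition} → (ν ≐ check x) p →
    IsSuccessor (check (successor x)) ν p
  check-isSuccessor x ν {p} ν≐x y =
    ⇒-intro (λ q q≤p y∈ → case-check y (successor x) ∨-regular y∈ λ
      { r r≤q (inj₁ i) e → ∨-introˡ (mono (∈-regular y ν))
          (∈-congʳ y (check x) ν (≐-sym ν (check x) (at (≤-trans r≤q q≤p)))
            (∈-congˡ (check (el x i)) y (check x) (≐-sym y _ e) (check-∈ x i)))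
      ; r r≤q (inj₂ _) e → ∨-introʳ (mono (≐-regular y ν))
          (≐-trans y (check x) ν e (≐-sym ν (check x) (at (≤-trans r≤q q≤p)))) }) ,
    ⇒-intro (λ q q≤p h → case-∨ (∈-regular y (check (successor x))) h
      (λ r r≤q y∈ν → case-check y x (∈-regular y (check (successor x)))
        (∈-congʳ y ν (check x) (at (≤-trans r≤q q≤p)) y∈ν)
        λ s s≤r i e → ∈-congˡ (check (el x i)) y (check (successor x)) (≐-sym y _ e)
          (check-∈ (successor x) (inj₁ i)))
      (λ r r≤q y≐ν → ∈-congˡ (check x) y (check (successor x))
        (≐-sym y (check x) (≐-trans y ν (check x) y≐ν (at (≤-trans r≤q q≤p))))
        (check-∈ (successor x) (inj₂ zero))))
    where
    at : ∀ {q : Condition} → q ≤ p → (ν ≐ check x) q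
    at q≤p = mono (≐-regular ν (check x)) q≤p ν≐x

  check-ω-isInductive : ∀ {p : Condition} → IsInductive (check ω) p
  check-ω-isInductive =
    ∃∈-intro (check ω) (check (numeral 0)) (mono (IsEmpty-regular (check (numeral 0))))
      (check-∈ ω 0) check-0-isEmpty ,
    ∀∈-intro (check ω) λ n q q≤p n∈ω → case-check n ω ∃-regular n∈ω λ r r≤q i e →
      ∃∈-intro (check ω) (check (numeral (suc i)))
        (mono (IsSuccessor-regular (check (numeral (suc i))) n))
        (check-∈ ω (suc i)) (check-isSuccessor (numeral i) n e)

  -- Induction in the metatheory: by extensionality, the empty set and the successors that `v`
  -- provides are forced to equal the check names of the numerals.
  inductive-∋-numeral : ∀ (v : Name) {p : Condition} → IsInductive v p →
    ∀ n → (check (numeral n) ∈̇ v) p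
  inductive-∋-numeral v (zero∈ , _) zero =
    case-∃∈ v (∈-regular (check (numeral 0)) v) zero∈ λ q q≤p e e∈v e-empty →
      ∈-congˡ e (check (numeral 0)) v
        (≐-ext e (check (numeral 0))
          (λ z r r≤q z∈e → ⊥-elim (e-empty z r r≤q z∈e))
          (λ z r r≤q z∈0 → ⊥-elim (check-0-isEmpty z r ≤-refl z∈0)))
        e∈v
  inductive-∋-numeral v {p} ind@(_ , suc∈) (suc n) =
    case-∃∈ v (∈-regular n⁺ v)
      (∀∈-elim v n′ ∃-regular suc∈ (inductive-∋-numeral v ind n)) λ q q≤p m m∈v m-suc →
      ∈-congˡ m n⁺ v
        (≐-ext m n⁺
          (λ z r r≤q z∈m → ⇔-from (∈-regular z n⁺) (mono ∨-regular) (n⁺-suc z)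
            (⇔-to (mono (∈-regular z m)) ∨-regular
              (mono (IsSuccessor-regular m n′) r≤q m-suc z) z∈m))
          (λ z r r≤q z∈n⁺ → ⇔-from (∈-regular z m) (mono ∨-regular)
            (mono (IsSuccessor-regular m n′) r≤q m-suc z)
            (⇔-to (mono (∈-regular z n⁺)) ∨-regular (n⁺-suc z) z∈n⁺)))
        m∈v
    where
    n′ = check (numeral n)
    n⁺ = check (numeral (suc n))
    n⁺-suc : ∀ {q : Condition} → IsSuccessor n⁺ n′ q
    n⁺-suc = check-isSuccessor (numeral n) n′ (≐-refl n′)

  check-ω-isω : ∀ {p : Condition} → Isω (check ω) p
  check-ω-isω = check-ω-isInductive , λ v → ⇒-intro λ q _ ind →
    ∀∈-intro (check ω) λ n r r≤q n∈ω → case-check n ω (∈-regular n v) n∈ω λ s s≤r i e →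
      ∈-congˡ (check (numeral i)) n v (≐-sym n _ e)
        (inductive-∋-numeral v (mono (IsInductive-regular v) (≤-trans s≤r r≤q) ind) i)

  -- Names for countable sets

  module _ {A : Set} (ρ : A → Name) (c : A → Condition) (e : ℕ → Maybe A) where

    Entry : Set
    Entry = Σ[ n ∈ ℕ ] Σ[ a ∈ A ] e n ≡ just a

    value : Entry → Name
    value (_ , a , _) = ρ a

    position : Entry → Name
    position (n , _) = check (numeral n)

    presence : Entry → Condition
    presence (_ , a , _) = c a

    -- In the extension by `G`, `range` is the set of the `ρ a` with `a` listed by `e` and `c a` in
    -- `G`. The other name is the partial function on ω that lists this set; it is undefined at `n`
    -- if `e n` is `nothing` or the condition of its element is outside `G`.
    range enumeration : Name
    range       = sup Entry value presence
    enumeration = sup Entry (λ k → pair (position k) (value k)) presence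

    case-Maps : ∀ {χ : Ω} {p : Condition} (a b : Name) → Regular χ → Maps enumeration a b p →
      (∀ (q : Condition) → q ≤ p → (k : Entry) → (a ≐ position k) q → (b ≐ value k) q → χ q) → χ p
    case-Maps a b R h K = case-∃∈ enumeration R h λ q q≤p z z∈ zab →
      case-∈ z enumeration R z∈ λ r r≤q k _ z≐ →
        let pk  = pair (position k) (value k)
            pab = IsPair-resp z pk a b z≐ (mono (IsPair-regular z a b) r≤q zab)
        in K r (≤-trans r≤q q≤p) k
             (IsPair-injectiveˡ pk a b (position k) (value k) pab (pair-isPair (position k) (value k)))
             (IsPair-injectiveʳ pk a b (position k) (value k) pab (pair-isPair (position k) (value k)))

    value-unique : ∀ (k l : Entry) → proj₁ k ≡ proj₁ l → value k ≡ value l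
    value-unique (n , w , ew) (.n , v , ev) refl with trans (sym ew) ev
    ... | refl = refl

    -- Equality of two positions is reflected to the ground model, where it yields the same `n`, and
    -- `e n` determines the value.
    enumeration-isFunctional : ∀ {p : Condition} → IsFunctional enumeration p
    enumeration-isFunctional a b c = ⇒-intro λ q _ (ab , ac) →
      case-Maps a b (≐-regular b c) ab λ r r≤q k a≐k b≐k →
        case-Maps a c (≐-regular b c) (mono ∃-regular r≤q ac) λ s s≤r l a≐l c≐l →
          let n≡m = numeral-injective (check-reflect-≐ (numeral (proj₁ k)) (numeral (proj₁ l))
                      (≐-trans (position k) a (position l)
                        (≐-sym a (position k) (mono (≐-regular a (position k)) s≤r a≐k)) a≐l))
          in ≐-trans b (value l) c
               (subst (λ v → (b ≐ v) s) (value-unique k l n≡m) (mono (≐-regular b (value k)) s≤r b≐k))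
               (≐-sym c (value l) c≐l)

    range-isCountable : ∀ {p : Condition} → IsCountable range p
    range-isCountable = ∃-intro (check ω) (mono ∃-regular)
      (∃-intro enumeration
        (mono (∧-regular
          (∧-regular (IsInductive-regular (check ω))
            (∀-regular λ v → ⇒-regular (mono (IsInductive-regular v))))
          (∧-regular
            (∀-regular λ a → ∀-regular λ b → ∀-regular λ c →
              ⇒-regular (mono (∧-regular ∃-regular ∃-regular)))
            (∀∈-regular range))))
        (check-ω-isω , enumeration-isFunctional ,
         ∀∈-intro range λ x q _ x∈ → case-∈ x range ∃-regular x∈ λ r r≤q k r≤ x≐ →
           -- Only the equality of `x` with `value k` is forced, so the member `z` of `enumeration`
           -- has to be recognised as a pair of `n` and `x`.
           let n = position k ; z = pair n (value k) in
           ∃∈-intro (check ω) n (mono ∃-regular) (check-∈ ω (proj₁ k))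
             (∃∈-intro enumeration z (mono (IsPair-regular z n x)) (member-∈ enumeration k r≤)
               (IsPair-resp (pair n x) z n x (pair-congʳ n x (value k) x≐) (pair-isPair n x)))))

  -- The topology generated by a basis of the ground model.  Its name consists
  -- of the nice names for subsets of X that are forced to be open.

  module GeneratedTopology (X τ : V) (τ⊆X : ∀ (j : Ix τ) (k : Ix (el τ j)) → el (el τ j) k ∈ X) where

    IsOpen : Name → Ω
    IsOpen u = ∀∈ u λ x → ∃∈ (check τ) λ b → x ∈̇ b ∧̇ b ⊆̇ u

    subset : (Ix X × Condition → Bool) → Name
    subset χ = sup (Σ[ z ∈ Ix X × Condition ] T (χ z)) (λ ((i , _) , _) → check (el X i))
      (λ ((_ , p) , _) → p)

    topology : Name
    topology = sup
      -- `IsOpen` takes values in `Set₁`; `True` of its decision is small enough for the index set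
      -- of a name.
      (Σ[ χ ∈ (Ix X × Condition → Bool) ] Σ[ p ∈ Condition ] True (em {P = IsOpen (subset χ) p}))
      (λ (χ , _) → subset χ) (λ (_ , p , _) → p)

    IsOpen-resp : ∀ (u v : Name) {p : Condition} → (u ≐ v) p → IsOpen u p → IsOpen v p
    IsOpen-resp u v u≐v u-open = ∀∈-intro v λ x q q≤p x∈v →
      case-∃∈ (check τ) ∃-regular
        (∀∈-elim u x ∃-regular (mono (∀∈-regular u) q≤p u-open)
          (∈-congʳ x v u (≐-sym u v (mono (≐-regular u v) q≤p u≐v)) x∈v))
        λ r r≤q b b∈τ (x∈b , b⊆u) →
          ∃∈-intro (check τ) b (mono (∧-regular (∈-regular x b) (∀∈-regular b))) b∈τ
            (x∈b , ∀∈-intro b λ y s s≤r y∈b →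
              ∈-congʳ y u v (mono (≐-regular u v) (≤-trans s≤r (≤-trans r≤q q≤p)) u≐v)
                (⊆-elim b u y (mono (∀∈-regular b) s≤r b⊆u) y∈b))

    topology-∋⇒open : ∀ (u : Name) {p : Condition} → (u ∈̇ topology) p → IsOpen u p
    topology-∋⇒open u h = case-∈ u topology (∀∈-regular u) h λ q q≤p (χ , c , t) q≤c u≐ →
      IsOpen-resp (subset χ) u (≐-sym u (subset χ) u≐)
        (mono (∀∈-regular (subset χ)) q≤c (toWitness t))

    module _ (u : Name) where
      points : Ix X × Condition → Bool
      points (i , r) = isYes (em {P = (check (el X i) ∈̇ u) r})

      -- Openness puts each member of `u` into a basic set of the ground model, hence into `X`, so a
      -- name built from points of `X` loses nothing.
      ≐-points : ∀ {p : Condition} → IsOpen u p → (u ≐ subset points) p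
      ≐-points u-open = ≐-ext u (subset points)
        (λ z q q≤p z∈u → case-∃∈ (check τ) (∈-regular z (subset points))
          (∀∈-elim u z ∃-regular (mono (∀∈-regular u) q≤p u-open) z∈u)
          λ r r≤q b b∈τ (z∈b , _) → case-check b τ (∈-regular z (subset points)) b∈τ
          λ s s≤r j b≐ → case-check z (el τ j) (∈-regular z (subset points))
            (∈-congʳ z b (check (el τ j)) b≐ (mono (∈-regular z b) s≤r z∈b))
          λ t t≤s k z≐ →
            let (i , e) = τ⊆X j k
                x       = check (el X i)
                z≐x     = ≐-trans z (check (el (el τ j) k)) x z≐ (check-cong (el (el τ j) k) (el X i) e)
                t≤q     = ≤-trans t≤s (≤-trans s≤r r≤q)
                x∈u     = ∈-congˡ z x u z≐x (mono (∈-regular z u) t≤q z∈u)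
            in ∈-congˡ x z (subset points) (≐-sym z x z≐x)
                 (member-∈ (subset points) ((i , t) , fromWitness x∈u) ≤-refl))
        (λ z q q≤p z∈ → case-∈ z (subset points) (∈-regular z u) z∈
          λ r r≤q ((i , c) , t) r≤c z≐ → ∈-congˡ (check (el X i)) z u (≐-sym z _ z≐)
            (mono (∈-regular (check (el X i)) u) r≤c (toWitness t)))

    open⇒topology-∋ : ∀ (u : Name) {p : Condition} → IsOpen u p → (u ∈̇ topology) p
    open⇒topology-∋ u {p} u-open =
      ∈-congˡ (subset (points u)) u topology (≐-sym u (subset (points u)) u≐)
        (member-∈ topology (points u , p , fromWitness (IsOpen-resp u (subset (points u)) u≐ u-open)) ≤-refl)
      where u≐ = ≐-points u u-open

    topology-hasBasis : ∀ {p : Condition} → HasBasis topology (check τ) p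
    topology-hasBasis u = ⇒-intro (λ _ _ → topology-∋⇒open u) , ⇒-intro (λ _ _ → open⇒topology-∋ u)

    HasBasis-regular : ∀ (σ β : Name) → Regular (HasBasis σ β)
    HasBasis-regular σ β = ∀-regular λ u → ⇔-regular (mono (∈-regular u σ)) (mono (∀∈-regular u))

-- Lindelöf spaces in the universe

module _ (em : Classical) where
  open Interpretation universe
  open Properties universe

  private
    dne : ∀ {A : Set₁} → ¬ ¬ A → A
    dne = decidable-stable em

    ⇒-map : ∀ {A A′ B B′ : Set₁} → (A′ → A) → (B → B′) → (A ⇒̇ B) → (A′ ⇒̇ B′)
    ⇒-map f g h (a , ¬b) = h (f a , ¬b ∘ g)

    ∨-map : ∀ {A A′ B B′ : Set₁} → (A → A′) → (B → B′) → (A ∨̇ B) → (A′ ∨̇ B′)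
    ∨-map f g h (¬a , ¬b) = h (¬a ∘ f , ¬b ∘ g)

    ⇒-apply : ∀ {A B : Set₁} → (A ⇒̇ B) → A → B
    ⇒-apply h a = dne λ ¬b → h (a , ¬b)

    ∃-witness : ∀ {φ : Dom → Set₁} → ∃̇ φ → Σ Dom φ
    ∃-witness h = dne λ ¬w → h λ x φx → ¬w (x , φx)

  IsDoubleton-respˡ : ∀ z a a′ b → proj₁ a ≈ proj₁ a′ → IsDoubleton z a b → IsDoubleton z a′ b
  IsDoubleton-respˡ z a a′ b a≈a′ h y =
    ⇒-map id (∨-map (λ (lift e) → lift (≈-trans (proj₁ y) (proj₁ a) (proj₁ a′) e a≈a′)) id) (proj₁ (h y)) ,
    ⇒-map (∨-map (λ (lift e) → lift (≈-trans (proj₁ y) (proj₁ a′) (proj₁ a) e (≈-sym (proj₁ a) (proj₁ a′) a≈a′))) id) id (proj₂ (h y))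

  IsSingleton-resp : ∀ z a a′ → proj₁ a ≈ proj₁ a′ → IsDoubleton z a a → IsDoubleton z a′ a′
  IsSingleton-resp z a a′ a≈a′ h y =
    ⇒-map id (∨-map to to) (proj₁ (h y)) , ⇒-map (∨-map from from) id (proj₂ (h y))
    where
    to : y ≐ a → y ≐ a′
    to (lift e) = lift (≈-trans (proj₁ y) (proj₁ a) (proj₁ a′) e a≈a′)
    from : y ≐ a′ → y ≐ a
    from (lift e) = lift (≈-trans (proj₁ y) (proj₁ a′) (proj₁ a) e (≈-sym (proj₁ a) (proj₁ a′) a≈a′))

  Maps-respˡ : ∀ f a a′ b → proj₁ a ≈ proj₁ a′ → Maps f a b → Maps f a′ b
  Maps-respˡ f a a′ b a≈a′ h k = h λ z (z∈f , zab) → k z (z∈f , λ w →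
    ⇒-map id (∨-map (IsSingleton-resp w a a′ a≈a′) (IsDoubleton-respˡ w a a′ b a≈a′)) (proj₁ (zab w)) ,
    ⇒-map (∨-map (IsSingleton-resp w a′ a a′≈a) (IsDoubleton-respˡ w a′ a b a′≈a)) id (proj₂ (zab w)))
    where a′≈a = ≈-sym (proj₁ a) (proj₁ a′) a≈a′

  ω-isInductive : IsInductive (ω , tt)
  ω-isInductive =
    (λ k → k (numeral 0 , tt) (lift (0 , ≈-refl (numeral 0)) , λ { y (lift (() , _)) })) ,
    λ { (n , _) (lift (i , n≈) , ¬h) → ¬h λ k → k (numeral (suc i) , tt)
      (lift (suc i , ≈-refl (numeral (suc i))) , λ (y , _) →
        (λ { (lift (inj₁ j , e) , ¬∨) → ¬∨ λ (¬∈ , _) →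
               ¬∈ (lift (∈-respʳ (numeral i) n (≈-sym n _ n≈) (j , e)))
           ; (lift (inj₂ _ , e) , ¬∨) → ¬∨ λ (_ , ¬≐) →
               ¬≐ (lift (≈-trans y (numeral i) n e (≈-sym n _ n≈))) }) ,
        (λ (h , ¬∈) → h
          ( (λ (lift y∈n) → let (j , e) = ∈-respʳ n (numeral i) n≈ y∈n in ¬∈ (lift (inj₁ j , e)))
          , (λ (lift y≈n) → ¬∈ (lift (inj₂ zero , ≈-trans y n _ y≈n n≈)))))) }

  topology-⊆ : ∀ X τ → IsTopologicalSpace X τ → ∀ (j : Ix τ) (k : Ix (el τ j)) → el (el τ j) k ∈ X
  topology-⊆ X τ (τ⊆ , _) j k = lower (⇒-apply
    (⇒-apply (τ⊆ (el τ j , tt)) (lift (el-∈ τ j)) (el (el τ j) k , tt)) (lift (el-∈ (el τ j) k)))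

  -- Here `R j w` is to be read as saying that `w` certifies the basic set with index `j`. The
  -- Lindelöf property, a formula about sets and functions in the universe, is turned into a
  -- sequence of certificates.
  module _ (X τ : V) {W : Set} (R : Ix τ → W → Set₁)
           (covers : ∀ i → ∃[ j ] ∃[ w ] R j w × el X i ∈ el τ j) where

    private
      c : V
      c = sup (Σ[ j ∈ Ix τ ] True (em {P = Σ[ w ∈ W ] R j w})) (el τ ∘ proj₁)

      c⊆τ : (c , tt) ⊆̇ (τ , tt)
      c⊆τ x (lift ((j , _) , e) , ¬∈) = ¬∈ (lift (j , e))

      c-covers : Covers (c , tt) (X , tt)
      c-covers x (lift (i , e) , ¬h) =
        let (j , w , r , x∈) = covers i
        in ¬h λ k → k (el τ j , tt)
             (lift ((j , fromWitness (w , r)) , ≈-refl (el τ j)) , lift (∈-respˡ (el τ j) e x∈))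

      module Subcover (d ω′ f : V)
        (d⊆c : (d , tt) ⊆̇ (c , tt))
        (d-covers : Covers (d , tt) (X , tt))
        (ω′-isω : Isω (ω′ , tt))
        (f-functional : IsFunctional (f , tt))
        (f-onto : ∀∈ (d , tt) λ x → ∃∈ (ω′ , tt) λ n → Maps (f , tt) n x) where

        -- Minimality of `ω′` applied to the inductive set `ω`; thus the arguments of `f` that
        -- matter are numerals.
        ω′⊆ω : ∀ n → n ∈ ω′ → n ∈ ω
        ω′⊆ω n n∈ = lower (⇒-apply (⇒-apply (proj₂ ω′-isω (ω , tt)) ω-isInductive (n , tt)) (lift n∈))

        Hit : ℕ → Set₁
        Hit n = Σ[ k ∈ Ix d ] Maps (f , tt) (numeral n , tt) (el d k , tt)

        in-c : ∀ k → el d k ∈ c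
        in-c k = lower (⇒-apply (d⊆c (el d k , tt)) (lift (el-∈ d k)))

        witness : Ix d → W
        witness k = proj₁ (toWitness (proj₂ (proj₁ (in-c k))))

        enum : ℕ → Maybe W
        enum n with em {P = Hit n}
        ... | yes (k , _) = just (witness k)
        ... | no _        = nothing

        enum-hit : ∀ n → Hit n → Σ[ h ∈ Hit n ] enum n ≡ just (witness (proj₁ h))
        enum-hit n hit with em {P = Hit n}
        ... | yes hit′ = hit′ , refl
        ... | no ¬hit  = contradiction hit ¬hit

        hits : ∀ i → ∃[ n ] Σ[ h ∈ Hit n ] el X i ∈ el d (proj₁ h)
        hits i with ∃-witness (⇒-apply (d-covers (el X i , tt)) (lift (el-∈ X i)))
        ... | (u , _) , lift (k , u≈) , lift x∈u
          with ∃-witness (⇒-apply (f-onto (el d k , tt)) (lift (el-∈ d k)))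
        ... | (m , _) , lift m∈ , fm with ω′⊆ω m m∈
        ... | n , m≈n = n , (k , Maps-respˡ (f , tt) (m , tt) (numeral n , tt) (el d k , tt) m≈n fm) ,
                        ∈-respʳ u (el d k) u≈ x∈u

        enum-covers : ∀ i → ∃[ n ] ∃[ w ] ∃[ j ] enum n ≡ just w × R j w × el X i ∈ el τ j
        enum-covers i with hits i
        ... | n , (k , fk) , x∈ with enum-hit n (k , fk)
        -- The index `k′` chosen by `enum` may differ from `k`, but functionality of `f` makes the
        -- two elements of `d` equal.
        ... | (k′ , fk′) , e = n , witness k′ , proj₁ (proj₁ (in-c k′)) , e ,
          proj₂ (toWitness (proj₂ (proj₁ (in-c k′)))) ,
          ∈-respʳ (el d k′) _ (proj₂ (in-c k′)) (∈-respʳ (el d k) (el d k′)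
            (lower (⇒-apply (f-functional (numeral n , tt) (el d k , tt) (el d k′ , tt)) (fk , fk′))) x∈)

    lindelöf-enumeration : IsLindelöfSpace X τ → Σ[ e ∈ (ℕ → Maybe W) ]
      (∀ i → ∃[ n ] ∃[ w ] ∃[ j ] e n ≡ just w × R j w × el X i ∈ el τ j)
    lindelöf-enumeration lindelöf
      with ∃-witness (⇒-apply (lindelöf (c , tt)) (c⊆τ , c-covers))
    ... | (d , _) , d⊆c , d-countable , d-covers with ∃-witness d-countable
    ... | (ω′ , _) , h with ∃-witness h
    ... | (f , _) , isω , functional , onto =
      Subcover.enum d ω′ f d⊆c d-covers isω functional onto ,
      Subcover.enum-covers d ω′ f d⊆c d-covers isω functional onto

-- Preservation

module Preservation (em : Classical) (θ X τ P L : V)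
  (poset : Forcing.IsPoset P L)
  (P⊆H : ∀ i → H θ (el P i))
  (τ-isTopology : IsTopologicalSpace X τ)
  (τ-isLindelöf : IsLindelöfSpace X τ)
  (stationary : IsStationary (H θ)
    (λ M → M ≺ H θ × ⟨ P , L ⟩ ∈ M × Forcing.IsStronglyProperFor P L M))
  where

  open Forcing P L
  open Interpretation forcing
  open Properties forcing
  open ForcingLogic em P L poset
  open Regular
  open GeneratedTopology X τ (topology-⊆ em X τ τ-isTopology)

  -- A countable subcover of a forced cover

  module Subcover {A : Set} (ρ : A → Name) (l : A → Condition) (p : Condition)
    (c⊆ : (sup A ρ l ⊆̇ topology) p) (c-covers : Covers (sup A ρ l) (check X) p) where

    c : Name
    c = sup A ρ l

    W : Set
    W = Σ[ t ∈ Condition ] Σ[ a ∈ A ] t ≤ l a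

    Below : Condition → Ix τ → W → Set₁
    Below s j (t , a , _) = t ≤ s × (check (el τ j) ⊆̇ ρ a) t

    -- Statements about the ground model become regular formulas, so the `case-` rules can be used
    -- to prove them.
    constant-regular : (E : Set₁) → Regular (λ _ → E)
    constant-regular E = record
      { mono  = λ _ e → e
      ; local = λ {p} d → proj₂ (proj₂ (d p ≤-refl))
      }

    -- Below `s` the point lies in some member of `c`. Stronger conditions identify that member with
    -- some `ρ a`, which is open, and then decide a basic set around the point inside it. That the
    -- point belongs to this basic set is reflected to the ground model.
    below-covers : ∀ s → s ≤ p → ∀ i → ∃[ j ] ∃[ w ] Below s j w × el X i ∈ el τ j
    below-covers s s≤p i = case-∃∈ c E-regular
      (∀∈-elim (check X) x ∃-regular (mono (∀∈-regular (check X)) s≤p c-covers) (check-∈ X i))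
      λ q q≤s u u∈c x∈u → case-∈ u c E-regular u∈c λ r r≤q a r≤a u≐ →
      let ν      = ρ a
          r≤p    = ≤-trans r≤q (≤-trans q≤s s≤p)
          x∈ν    = ∈-congʳ x u ν u≐ (mono (∈-regular x u) r≤q x∈u)
          ν-open = topology-∋⇒open ν (⊆-elim c topology ν
                     (mono (∀∈-regular c) r≤p c⊆) (member-∈ c a r≤a))
      in case-∃∈ (check τ) E-regular (∀∈-elim ν x ∃-regular ν-open x∈ν)
      λ t t≤r b b∈τ (x∈b , b⊆ν) → case-check b τ E-regular b∈τ λ v v≤t j b≐ →
      let U = check (el τ j)
      in j , (v , a , ≤-trans v≤t (≤-trans t≤r r≤a)) ,
         (≤-trans v≤t (≤-trans t≤r (≤-trans r≤q q≤s)) ,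
          ∀∈-intro U λ y y′ y′≤v y∈U → ⊆-elim b ν y
            (mono (∀∈-regular b) (≤-trans y′≤v v≤t) b⊆ν)
            (∈-congʳ y U b (≐-sym b U (mono (≐-regular b U) y′≤v b≐)) y∈U)) ,
         check-reflect-∈ (el X i) (el τ j) (∈-congʳ x b U b≐ (mono (∈-regular x b) v≤t x∈b))
      where
      x = check (el X i)
      E-regular = constant-regular (∃[ j ] ∃[ w ] Below s j w × el X i ∈ el τ j)

    -- The decision is a parameter so that proofs can match on it. Conditions not below `p` get the
    -- empty enumeration.
    enumBy : ∀ s → Dec (s ≤ p) → ℕ → Maybe W
    enumBy s (yes s≤p) =
      proj₁ (lindelöf-enumeration em X τ (Below s) (below-covers s s≤p) τ-isLindelöf)
    enumBy s (no _)    = λ _ → nothing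

    Covered : Condition → Ix X → (ℕ → Maybe W) → Set₁
    Covered s i e = Σ[ n ∈ ℕ ] Σ[ w ∈ W ] e n ≡ just w × proj₁ w ≤ s ×
      (check (el X i) ∈̇ ρ (proj₁ (proj₂ w))) (proj₁ w)

    enumBy-covers : ∀ s (s≤p? : Dec (s ≤ p)) → s ≤ p → ∀ i → Covered s i (enumBy s s≤p?)
    enumBy-covers s (no s≰p) s≤p i = contradiction s≤p s≰p
    enumBy-covers s (yes s≤p) _ i =
      let n , w , j , e , (t≤s , U⊆) , k , x≈ =
            proj₂ (lindelöf-enumeration em X τ (Below s) (below-covers s s≤p) τ-isLindelöf) i
          x = check (el X i)
          U = check (el τ j)
      in n , w , e , t≤s , ⊆-elim U (ρ (proj₁ (proj₂ w))) x U⊆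
           (∈-congˡ (check (el (el τ j) k)) x U
             (check-cong (el (el τ j) k) (el X i) (≈-sym (el X i) (el (el τ j) k) x≈))
             (check-∈ (el τ j) k))

    enum : Condition → ℕ → Maybe W
    enum s = enumBy s em

    commonBy : ∀ s → Dec (Compatible s p) → Condition
    commonBy s (yes (u , _)) = u
    commonBy s (no _)        = p

    commonBy-≤ : ∀ s (c? : Dec (Compatible s p)) → Compatible s p →
      commonBy s c? ≤ s × commonBy s c? ≤ p
    commonBy-≤ s (yes (_ , u≤)) _ = u≤
    commonBy-≤ s (no ¬h)        h = contradiction h ¬h

    common : Condition → Condition
    common s = commonBy s em

    -- The operations under which the model has to be closed, merged into one sequence: first the
    -- common extension with `p`, then the conditions of the enumerated witnesses. Gaps are filled
    -- with `p`.
    step : Condition → ℕ → Condition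
    step s zero    = common s
    step s (suc n) = maybe′ proj₁ p (enum s n)

    module Generic (M : V) (M-closed : ClosedUnder (H θ) (el P p) (el P) (λ s n → el P (step s n)) M)
                   (r : Condition) (r≤p : r ≤ p) (r-generic : IsStronglyGeneric M r) where

      open ClosedUnder M-closed using (infinite) renaming (step to closed)
      open Bijection infinite using () renaming (to to nth; surjective to nth-surjective)

      -- A condition in `M` may have several indices in `P`, with different enumerations, and
      -- closure provides only one whose steps lie in `M`. The row of `entry` for that condition
      -- must come from such an index.
      Represents : ℕ → Condition → Set
      Represents m s = el P s ≈ el M (nth m) × (∀ n → step s n ∈ᶜ M)

      entryBy : ∀ {m} → Dec (∃ (Represents m)) → ℕ → Maybe W
      entryBy (yes (s , _)) = enum s
      entryBy (no _)        = λ _ → nothing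

      entry : ℕ → ℕ → Maybe W
      entry m = entryBy {m} em

      EntryOf : Condition → (ℕ → Maybe W) → Set
      EntryOf s e = Σ[ s′ ∈ Condition ]
        el P s ≈ el P s′ × (∀ n → step s′ n ∈ᶜ M) × (∀ n → e n ≡ enum s′ n)

      entryBy-enum : ∀ {m} s → el P s ≈ el M (nth m) → s ∈ᶜ M →
        (d : Dec (∃ (Represents m))) → EntryOf s (entryBy d)
      entryBy-enum s s≈ s∈M (yes (s′ , s′≈ , h)) =
        s′ , ≈-trans _ _ _ s≈ (≈-sym _ _ s′≈) , h , λ _ → refl
      entryBy-enum s s≈ s∈M (no ¬found) =
        let (s′ , s≈s′ , h) = closed s s∈M
        in contradiction (s′ , ≈-trans _ _ _ (≈-sym _ _ s≈s′) s≈ , h) ¬found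

      entry-enum : ∀ s → s ∈ᶜ M → Σ[ m ∈ ℕ ] EntryOf s (entry m)
      entry-enum s s∈M@(i , s≈) =
        let (m , onto) = nth-surjective i
        in m , entryBy-enum s (≈-trans _ _ _ s≈ (≈-sym _ _ (onto refl))) s∈M em

      -- The rows of `entry` are merged by `unpair`. Each `ρ a` is labelled with the condition `t`
      -- of its witness instead of `l a`; as `t ≤ l a`, the result is still a subset of `c`.
      d : Name
      d = range (λ (_ , a , _) → ρ a) proj₁ (λ k → uncurry entry (unpair k))

      d⊆c : (d ⊆̇ c) r
      d⊆c = ∀∈-intro d λ x q _ x∈d → case-∈ x d (∈-regular x c) x∈d
        λ s _ (_ , (t , a , t≤a) , _) s≤t x≐ →
          ∈-congˡ (ρ a) x c (≐-sym x (ρ a) x≐) (member-∈ c a (≤-trans s≤t t≤a))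

      d-covers-densely : ∀ i q → q ≤ r → Σ[ z ∈ Condition ] z ≤ q × (∃∈ d λ u → check (el X i) ∈̇ u) z
      d-covers-densely i q q≤r =
        let (q̄ , q̄∈M , residue)             = r-generic q q≤r
            (s , q̄≈s , s-closed)            = closed q̄ q̄∈M
            -- First use of the residue, at `q̄` itself: `q̄` is compatible with `q`, which is below
            -- `p`, so its closed index `s` is compatible with `p`.
            (v , v≤q̄ , v≤q)                 = residue q̄ ≤-refl q̄∈M
            (u≤s , u≤p)                     = commonBy-≤ s em
              (v , ≤-trans v≤q̄ (≤-reflexive q̄≈s) , ≤-trans v≤q (≤-trans q≤r r≤p))
            -- `common s` is in `M`, but its own index need not be the one that its row was made
            -- from; `s′` is that index.
            (m , s′ , u≈s′ , s′-closed , e) = entry-enum (common s) (s-closed 0)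
            s′≤u                            = ≤-reflexive (≈-sym _ _ u≈s′)
            (n , w , e′ , t≤s′ , x∈)        = enumBy-covers s′ em (≤-trans s′≤u u≤p) i
            -- Second use of the residue, at the condition of `w`, which is below `q̄` and belongs
            -- to `M` as a later step of `s′`. The common extension `z` with `q` forces the point
            -- into `ν` and `ν` into `d`.
            (z , z≤t , z≤q)                 = residue (proj₁ w)
              (≤-trans t≤s′ (≤-trans s′≤u (≤-trans u≤s (≤-reflexive (≈-sym _ _ q̄≈s)))))
              (subst (λ z → maybe′ proj₁ p z ∈ᶜ M) e′ (s′-closed (suc n)))
            (k , ek)                        = unpair-surjective m n
            x                               = check (el X i)
            ν                               = ρ (proj₁ (proj₂ w))
        in z , z≤q , ∃∈-intro d ν (mono (∈-regular x ν))
             (member-∈ d (k , w , trans (cong (uncurry entry) ek) (trans (e n) e′)) z≤t)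
             (mono (∈-regular x ν) z≤t x∈)

      d-covers : Covers d (check X) r
      d-covers = ∀∈-intro (check X) λ x q q≤r x∈X → case-check x X ∃-regular x∈X λ s s≤q i x≐ →
        local ∃-regular λ t t≤s →
          let (z , z≤t , h) = d-covers-densely i t (≤-trans t≤s (≤-trans s≤q q≤r))
              x′            = check (el X i)
          in z , z≤t , case-∃∈ d ∃-regular h λ y y≤z u u∈d x′∈u →
               ∃∈-intro d u (mono (∈-regular x u)) u∈d
                 (∈-congˡ x′ x u (≐-sym x x′ (mono (≐-regular x x′) (≤-trans y≤z (≤-trans z≤t t≤s)) x≐)) x′∈u)

    subcover : Σ[ r ∈ Condition ] r ≤ p ×
      (∃̇ λ d → d ⊆̇ c ∧̇ IsCountable d ∧̇ Covers d (check X)) r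
    subcover
      -- The stationary set meets the club of closed sets; `base` puts `p` into the model, so strong
      -- properness applies to `p`.
      with M , M-closed , _ , _ , M-proper ← stationary
             (ClosedUnder (H θ) (el P p) (el P) (λ s n → el P (step s n)))
             (closedUnder-isClub em (H θ) (H-resp θ) (el P p) (P⊆H p) (el P)
               (λ s n → el P (step s n)) (λ s n → P⊆H (step s n)))
      with r , r≤p , r-generic ← M-proper p (ClosedUnder.base M-closed)
      = r , r≤p , ∃-intro d
          (mono (∧-regular (∀∈-regular d) (∧-regular ∃-regular (∀∈-regular (check X)))))
          (d⊆c , range-isCountable _ _ _ , d-covers)
      where open Generic M M-closed r r≤p r-generic

  -- The existential formula is regular, so forcing a subcover densely suffices: below any `r` the
  -- construction is run with `r` as its base condition.
  topology-isLindelöf : ∀ p → IsLindelöf (check X) topology p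
  topology-isLindelöf p c@(sup A ρ l) = ⇒-intro λ q _ (c⊆ , c-covers) → local ∃-regular λ r r≤q →
    Subcover.subcover ρ l r (mono (∀∈-regular c) r≤q c⊆) (mono (∀∈-regular (check X)) r≤q c-covers)

  forces-lindelöf : ForcesLindelöf X τ
  forces-lindelöf p = ∃-intro topology
    (mono (∧-regular (HasBasis-regular topology (check τ))
      (∀-regular λ c → ⇒-regular (mono (∧-regular (∀∈-regular c) (∀∈-regular (check X)))))))
    (topology-hasBasis , topology-isLindelöf p)

theorem4p6 : Classical →
    (θ X τ P L : V) → let open Forcing P L in
    IsRegular θ →
    LargeEnough θ X τ P →
    H θ ⟨ X , τ ⟩ →
    IsTopologicalSpace X τ →
    IsLindelöfSpace X τ →
    H θ ⟨ P , L ⟩ →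
    IsPoset →
    IsStationary (H θ) (λ M → M ≺ H θ × ⟨ P , L ⟩ ∈ M × IsStronglyProperFor M) →
    ForcesLindelöf X τ
theorem4p6 em θ X τ P L _ _ _ isTop isLind HPL poset stat =
  Preservation.forces-lindelöf em θ X τ P L poset
    -- Following the index `true` twice leads from `⟨ P , L ⟩` through the singleton of `P` to `P`,
    -- whose elements therefore lie in `H θ`.
    (λ i → H-el (H-el (H-el HPL true) true) i) isTop isLind stat
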